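{- Let $n,a,k\ge 1$ be integers and let $\vec p=(p_1,\dots,p_a)$ be a probability vector. Let $P_{n,a;\vec p}$ be the biased $a$-shuffle measure on the symmetric group $S_n$, let $P_{n,a;\vec p}^{*k}$ be its $k$-fold convolution, and let $U$ be the uniform distribution on $S_n$. Then $$\| P_{n,a;\vec p}^{*k}-U\| \le \binom{n}{2}\,\left[p_1^2+\cdots+p_a^2\right]^k .$$
   Context: Probability vector: real $p_i\ge 0$ with $\sum_{i=1}^a p_i=1$. Descents: $\pi\in S_n$ has a descent at position $i$ ($1\le i\le n-1$) if $\pi(i)>\pi(i+1)$; by convention every $\pi\in S_n$ also has a descent at position $n$. The descent set of $\pi$ is the set of positions at which it has a descent. The measure $P_{n,a;\vec p}$ on $S_n$ (biased riffle shuffle): first choose $(b_1,\dots,b_a)$, $b_i\ge 0$, $b_1+\cdots+b_a=n$, with probability $\binom{n}{b_1\cdots b_a}\prod_{i=1}^a p_i^{b_i}$; then choose uniformly one of the $\binom{n}{b_1\cdots b_a}$ permutations $\pi\in S_n$ such that the descent set of $\pi^{ -1}$ is contained in $\{b_1,b_1+b_2,\dots,b_1+\cdots+b_a=n\}$. $P^{*k}$ is the $k$-fold convolution of $P$, i.e. the law of a product of $k$ independent permutations each with law $P$. The total variation distance is $\|P_1-P_2\|=\frac12\sum_{x\in S_n}|P_1(x)-P_2(x)|$. -}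

module Defs where

open import Level using (0ℓ)
open import Algebra.Bundles using (RawSemiring)
open import Data.Nat.Base as ℕ using (ℕ; zero; suc; _!)
import Data.Nat.Properties as ℕ
import Data.Nat.DivMod as ℕ
import Data.Nat.Divisibility as ℕ
open import Data.Nat.Combinatorics using ([n∸k]!k!∣n!)
open import Data.Integer.Base using (+_)
open import Data.Rational.Base as ℚ using (ℚ; 0ℚ; 1ℚ; ½)
import Data.Rational.Properties as ℚ
open import Data.Rational.Solver using (module +-*-Solver)
open import Data.Bool.Base using (if_then_else_)
open import Data.Product.Base using (∃; _×_; _,_; proj₁; proj₂)
open import Data.Sum.Base using (_⊎_; inj₁; inj₂)
open import Data.Fin.Base as Fin using (Fin; zero; suc; toℕ)
import Data.Fin.Properties as Fin
open import Data.Fin.Permutation as Perm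
  using (Permutation′; _≈_; _⟨$⟩ʳ_; _∘ₚ_; flip; insert; remove)
open import Data.List.Base as List
  using (List; []; _∷_; allFin; upTo; cartesianProductWith; filter)
open import Data.List.Membership.Propositional using (_∈_)
open import Data.List.Membership.Propositional.Properties
  using (∈-filter⁺; ∈-filter⁻; ∈-cartesianProductWith⁺; ∈-upTo⁺; ∈-allFin)
import Data.List.Membership.Setoid as SetoidMembership
import Data.List.Relation.Unary.Any.Properties as Any
open import Data.List.Relation.Unary.Any using (here)
import Data.List.Relation.Unary.All as All
import Data.List.Relation.Unary.AllPairs as AllPairs
open import Data.List.Relation.Unary.Unique.Propositional using (Unique)
import Data.List.Relation.Unary.Unique.Propositional.Properties as Unique
import Data.List.Relation.Unary.Unique.Setoid as SetoidUnique
import Data.List.Relation.Unary.Unique.Setoid.Properties as SetoidUniqueₚ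
open import Data.Vec.Base as Vec using (Vec; []; _∷_; lookup)
import Data.Vec.Properties as Vec
open import Relation.Binary.Bundles using (Setoid)
open import Relation.Binary.PropositionalEquality
  using (_≡_; refl; sym; trans; cong; cong₂; subst; setoid)
open import Relation.Nullary.Decidable
  using (Dec; does; _×-dec_; _⊎-dec_; _→-dec_)

open ℚ.≤-Reasoning
open +-*-Solver using (solve; _:=_; _:+_; _:*_; _:-_; :-_)

-- Real numbers, as Cauchy sequences of rationals with a modulus of
-- convergence.  Equality and order are those of the limits.

record ℝ : Set where
  constructor mkℝ
  field
    seq    : ℕ → ℚ
    cauchy : ∀ ε → 0ℚ ℚ.< ε → ∃ λ N → ∀ m n → N ℕ.≤ m → N ℕ.≤ n →
             ℚ.∣ seq m ℚ.- seq n ∣ ℚ.≤ ε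

open ℝ public

infix 4 _≃_ _≤_

record _≃_ (x y : ℝ) : Set where
  constructor mk≃
  field
    close : ∀ ε → 0ℚ ℚ.< ε → ∃ λ N → ∀ n → N ℕ.≤ n →
            ℚ.∣ seq x n ℚ.- seq y n ∣ ℚ.≤ ε

record _≤_ (x y : ℝ) : Set where
  constructor mk≤
  field
    below : ∀ ε → 0ℚ ℚ.< ε → ∃ λ N → ∀ n → N ℕ.≤ n →
            seq x n ℚ.≤ seq y n ℚ.+ ε

private
  half+half : ∀ ε → ε ℚ.* ½ ℚ.+ ε ℚ.* ½ ≡ ε
  half+half ε = trans (sym (ℚ.*-distribˡ-+ ε ½ ½)) (ℚ.*-identityʳ ε)

  0<½* : ∀ {ε} → 0ℚ ℚ.< ε → 0ℚ ℚ.< ε ℚ.* ½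
  0<½* {ε} 0<ε = subst (ℚ._< ε ℚ.* ½) (ℚ.*-zeroˡ ½) (ℚ.*-monoˡ-<-pos ½ 0<ε)

  ∣∣-split : ∀ x y → ℚ.∣ x ∣ ℚ.≤ ℚ.∣ y ∣ ℚ.+ ℚ.∣ x ℚ.- y ∣
  ∣∣-split x y = subst (λ z → ℚ.∣ z ∣ ℚ.≤ ℚ.∣ y ∣ ℚ.+ ℚ.∣ x ℚ.- y ∣)
    (solve 2 (λ x y → y :+ (x :- y) := x) refl x y)
    (ℚ.∣p+q∣≤∣p∣+∣q∣ y (x ℚ.- y))

  ∣-∣-swap : ∀ x y → ℚ.∣ x ℚ.- y ∣ ≡ ℚ.∣ y ℚ.- x ∣
  ∣-∣-swap x y = trans (sym (ℚ.∣-p∣≡∣p∣ (x ℚ.- y)))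
    (cong ℚ.∣_∣ (solve 2 (λ x y → :- (x :- y) := y :- x) refl x y))

  ∣∣-lipschitz : ∀ x y → ℚ.∣ ℚ.∣ x ∣ ℚ.- ℚ.∣ y ∣ ∣ ℚ.≤ ℚ.∣ x ℚ.- y ∣
  ∣∣-lipschitz x y with ℚ.∣p∣≡p∨∣p∣≡-p (ℚ.∣ x ∣ ℚ.- ℚ.∣ y ∣)
  ... | inj₁ eq = subst (ℚ._≤ ℚ.∣ x ℚ.- y ∣) (sym eq) (shift x y)
    where
    shift : ∀ x y → ℚ.∣ x ∣ ℚ.- ℚ.∣ y ∣ ℚ.≤ ℚ.∣ x ℚ.- y ∣
    shift x y = subst (ℚ.∣ x ∣ ℚ.- ℚ.∣ y ∣ ℚ.≤_)
      (solve 2 (λ b d → (b :+ d) :- b := d) refl ℚ.∣ y ∣ ℚ.∣ x ℚ.- y ∣)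
      (ℚ.+-monoˡ-≤ (ℚ.- ℚ.∣ y ∣) (∣∣-split x y))
  ... | inj₂ eq = subst (ℚ._≤ ℚ.∣ x ℚ.- y ∣) (sym eq)
    (subst (ℚ.- (ℚ.∣ x ∣ ℚ.- ℚ.∣ y ∣) ℚ.≤_)
      (solve 2 (λ a d → (a :+ d) :- a := d) refl ℚ.∣ x ∣ ℚ.∣ x ℚ.- y ∣)
      (subst (ℚ._≤ (ℚ.∣ x ∣ ℚ.+ ℚ.∣ x ℚ.- y ∣) ℚ.- ℚ.∣ x ∣)
        (solve 2 (λ a b → b :- a := :- (a :- b)) refl ℚ.∣ x ∣ ℚ.∣ y ∣)
        (ℚ.+-monoˡ-≤ (ℚ.- ℚ.∣ x ∣)
          (subst (λ z → ℚ.∣ y ∣ ℚ.≤ ℚ.∣ x ∣ ℚ.+ z) (∣-∣-swap y x)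
            (∣∣-split y x)))))

  sum-close : ∀ {δ η} a b c d → ℚ.∣ a ℚ.- c ∣ ℚ.≤ δ → ℚ.∣ b ℚ.- d ∣ ℚ.≤ η →
    ℚ.∣ (a ℚ.+ b) ℚ.- (c ℚ.+ d) ∣ ℚ.≤ δ ℚ.+ η
  sum-close {δ} {η} a b c d a-c b-d = begin
    ℚ.∣ (a ℚ.+ b) ℚ.- (c ℚ.+ d) ∣
      ≡⟨ cong ℚ.∣_∣ (solve 4 (λ a b c d →
           (a :+ b) :- (c :+ d) := (a :- c) :+ (b :- d)) refl a b c d) ⟩
    ℚ.∣ (a ℚ.- c) ℚ.+ (b ℚ.- d) ∣
      ≤⟨ ℚ.∣p+q∣≤∣p∣+∣q∣ (a ℚ.- c) (b ℚ.- d) ⟩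
    ℚ.∣ a ℚ.- c ∣ ℚ.+ ℚ.∣ b ℚ.- d ∣
      ≤⟨ ℚ.+-mono-≤ a-c b-d ⟩
    δ ℚ.+ η ∎

  eventualBound : ∀ x → ∃ λ B → 0ℚ ℚ.< B ×
    ∃ λ N → ∀ n → N ℕ.≤ n → ℚ.∣ seq x n ∣ ℚ.≤ B
  eventualBound x with cauchy x 1ℚ (ℚ.positive⁻¹ 1ℚ)
  ... | N , close =
    ℚ.∣ seq x N ∣ ℚ.+ 1ℚ ,
    subst (ℚ._< ℚ.∣ seq x N ∣ ℚ.+ 1ℚ) (ℚ.+-identityʳ 0ℚ)
      (ℚ.+-mono-≤-< (ℚ.0≤∣p∣ (seq x N)) (ℚ.positive⁻¹ 1ℚ)) ,
    N , λ n N≤n → ℚ.≤-trans (∣∣-split (seq x n) (seq x N))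
      (ℚ.+-monoʳ-≤ ℚ.∣ seq x N ∣ (close n N N≤n ℕ.≤-refl))

fromℚ : ℚ → ℝ
fromℚ q = mkℝ (λ _ → q) λ ε 0<ε → 0 , λ _ _ _ _ →
  subst (ℚ._≤ ε) (sym (cong ℚ.∣_∣ (ℚ.+-inverseʳ q))) (ℚ.<⇒≤ 0<ε)

fromℕ : ℕ → ℝ
fromℕ n = fromℚ (+ n ℚ./ 1)

0ℝ 1ℝ : ℝ
0ℝ = fromℚ 0ℚ
1ℝ = fromℚ 1ℚ

infixl 6 _+_ _-_
infixl 7 _*_

_+_ : ℝ → ℝ → ℝ
x + y = mkℝ (λ n → seq x n ℚ.+ seq y n) λ ε 0<ε →
  let M , p = cauchy x (ε ℚ.* ½) (0<½* 0<ε)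
      N , q = cauchy y (ε ℚ.* ½) (0<½* 0<ε)
  in M ℕ.⊔ N , λ m n ≤m ≤n →
    subst (ℚ.∣ (seq x m ℚ.+ seq y m) ℚ.- (seq x n ℚ.+ seq y n) ∣ ℚ.≤_) (half+half ε)
      (sum-close (seq x m) (seq y m) (seq x n) (seq y n)
        (p m n (ℕ.m⊔n≤o⇒m≤o M N ≤m) (ℕ.m⊔n≤o⇒m≤o M N ≤n))
        (q m n (ℕ.m⊔n≤o⇒n≤o M N ≤m) (ℕ.m⊔n≤o⇒n≤o M N ≤n)))

-_ : ℝ → ℝ
- x = mkℝ (λ n → ℚ.- seq x n) λ ε 0<ε →
  let N , p = cauchy x ε 0<ε in
  N , λ m n N≤m N≤n → subst (ℚ._≤ ε)
    (trans (∣-∣-swap (seq x m) (seq x n))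
      (cong ℚ.∣_∣ (solve 2 (λ a b → b :- a := (:- a) :- (:- b)) refl (seq x m) (seq x n))))
    (p m n N≤m N≤n)

_-_ : ℝ → ℝ → ℝ
x - y = x + (- y)

∣_∣ : ℝ → ℝ
∣ x ∣ = mkℝ (λ n → ℚ.∣ seq x n ∣) λ ε 0<ε →
  let N , p = cauchy x ε 0<ε in
  N , λ m n N≤m N≤n →
    ℚ.≤-trans (∣∣-lipschitz (seq x m) (seq x n)) (p m n N≤m N≤n)

private
  ∣*∣-mono : ∀ {u v b d} → 0ℚ ℚ.≤ b →
    ℚ.∣ u ∣ ℚ.≤ b → ℚ.∣ v ∣ ℚ.≤ d → ℚ.∣ u ℚ.* v ∣ ℚ.≤ b ℚ.* d
  ∣*∣-mono {u} {v} {b} {d} 0≤b u≤b v≤d = begin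
    ℚ.∣ u ℚ.* v ∣        ≡⟨ ℚ.∣p*q∣≡∣p∣*∣q∣ u v ⟩
    ℚ.∣ u ∣ ℚ.* ℚ.∣ v ∣  ≤⟨ ℚ.*-monoʳ-≤-nonNeg ℚ.∣ v ∣ {{ℚ.∣-∣-nonNeg v}} u≤b ⟩
    b ℚ.* ℚ.∣ v ∣        ≤⟨ ℚ.*-monoˡ-≤-nonNeg b {{ℚ.nonNegative 0≤b}} v≤d ⟩
    b ℚ.* d              ∎

  product-close : ∀ {A B δ} a b c d → 0ℚ ℚ.≤ A → 0ℚ ℚ.≤ B →
    ℚ.∣ a ∣ ℚ.≤ A → ℚ.∣ d ∣ ℚ.≤ B →
    ℚ.∣ b ℚ.- d ∣ ℚ.≤ δ → ℚ.∣ a ℚ.- c ∣ ℚ.≤ δ →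
    ℚ.∣ a ℚ.* b ℚ.- c ℚ.* d ∣ ℚ.≤ (A ℚ.+ B) ℚ.* δ
  product-close {A} {B} {δ} a b c d 0≤A 0≤B a≤A d≤B b-d a-c = begin
    ℚ.∣ a ℚ.* b ℚ.- c ℚ.* d ∣
      ≡⟨ cong ℚ.∣_∣ (solve 4 (λ a b c d →
           a :* b :- c :* d := a :* (b :- d) :+ d :* (a :- c)) refl a b c d) ⟩
    ℚ.∣ a ℚ.* (b ℚ.- d) ℚ.+ d ℚ.* (a ℚ.- c) ∣
      ≤⟨ ℚ.∣p+q∣≤∣p∣+∣q∣ (a ℚ.* (b ℚ.- d)) (d ℚ.* (a ℚ.- c)) ⟩
    ℚ.∣ a ℚ.* (b ℚ.- d) ∣ ℚ.+ ℚ.∣ d ℚ.* (a ℚ.- c) ∣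
      ≤⟨ ℚ.+-mono-≤ (∣*∣-mono {a} {b ℚ.- d} 0≤A a≤A b-d)
                    (∣*∣-mono {d} {a ℚ.- c} 0≤B d≤B a-c) ⟩
    A ℚ.* δ ℚ.+ B ℚ.* δ
      ≡⟨ sym (ℚ.*-distribʳ-+ δ A B) ⟩
    (A ℚ.+ B) ℚ.* δ ∎

  scale : ∀ {S ε} → 0ℚ ℚ.< S → 0ℚ ℚ.< ε → ∃ λ δ → 0ℚ ℚ.< δ × S ℚ.* δ ≡ ε
  scale {S} {ε} 0<S 0<ε = ℚ.1/ S ℚ.* ε ,
    subst (ℚ._< ℚ.1/ S ℚ.* ε) (ℚ.*-zeroʳ (ℚ.1/ S))
      (ℚ.*-monoʳ-<-pos (ℚ.1/ S) {{ℚ.1/pos⇒pos S}} 0<ε) ,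
    trans (sym (ℚ.*-assoc S (ℚ.1/ S) ε))
      (trans (cong (ℚ._* ε) (ℚ.*-inverseʳ S)) (ℚ.*-identityˡ ε))
    where
    instance
      S-pos : ℚ.Positive S
      S-pos = ℚ.positive 0<S
      S≢0 : ℚ.NonZero S
      S≢0 = ℚ.pos⇒nonZero S

_*_ : ℝ → ℝ → ℝ
x * y = mkℝ (λ n → seq x n ℚ.* seq y n) λ ε 0<ε →
  let A , 0<A , K , x≤A = eventualBound x
      B , 0<B , L , y≤B = eventualBound y
      δ , 0<δ , eq      = scale
        (subst (ℚ._< A ℚ.+ B) (ℚ.+-identityʳ 0ℚ) (ℚ.+-mono-< 0<A 0<B)) 0<ε
      M , p             = cauchy x δ 0<δ
      N , q             = cauchy y δ 0<δ
  in (K ℕ.⊔ L) ℕ.⊔ (M ℕ.⊔ N) , λ m n ≤m ≤n →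
    let KL≤m = ℕ.m⊔n≤o⇒m≤o (K ℕ.⊔ L) (M ℕ.⊔ N) ≤m
        KL≤n = ℕ.m⊔n≤o⇒m≤o (K ℕ.⊔ L) (M ℕ.⊔ N) ≤n
        MN≤m = ℕ.m⊔n≤o⇒n≤o (K ℕ.⊔ L) (M ℕ.⊔ N) ≤m
        MN≤n = ℕ.m⊔n≤o⇒n≤o (K ℕ.⊔ L) (M ℕ.⊔ N) ≤n
    in subst (ℚ.∣ seq x m ℚ.* seq y m ℚ.- seq x n ℚ.* seq y n ∣ ℚ.≤_) eq
      (product-close (seq x m) (seq y m) (seq x n) (seq y n)
        (ℚ.<⇒≤ 0<A) (ℚ.<⇒≤ 0<B)
        (x≤A m (ℕ.m⊔n≤o⇒m≤o K L KL≤m))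
        (y≤B n (ℕ.m⊔n≤o⇒n≤o K L KL≤n))
        (q m n (ℕ.m⊔n≤o⇒n≤o M N MN≤m) (ℕ.m⊔n≤o⇒n≤o M N MN≤n))
        (p m n (ℕ.m⊔n≤o⇒m≤o M N MN≤m) (ℕ.m⊔n≤o⇒m≤o M N MN≤n)))

ℝ-rawSemiring : RawSemiring 0ℓ 0ℓ
ℝ-rawSemiring = record
  { Carrier = ℝ ; _≈_ = _≃_ ; _+_ = _+_ ; _*_ = _*_ ; 0# = 0ℝ ; 1# = 1ℝ }

open import Algebra.Definitions.RawSemiring ℝ-rawSemiring public
  using (sum; product; _^_)

infix 5 sumOver
sumOver : ∀ {A : Set} → List A → (A → ℝ) → ℝ
sumOver xs f = List.foldr _+_ 0ℝ (List.map f xs)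

syntax sumOver xs (λ x → e) = Σ[ x ∈ xs ] e

IsProbabilityVector : ∀ {a} → (Fin a → ℝ) → Set
IsProbabilityVector p = (∀ i → 0ℝ ≤ p i) × sum p ≃ 1ℝ

-- A permutation carries proofs, so permutations are compared pointwise, by
-- _≈_; up to _≈_ this list contains every permutation exactly once.

permutations : ∀ n → List (Permutation′ n)
permutations zero    = Perm.id ∷ []
permutations (suc n) =
  cartesianProductWith (insert zero) (allFin (suc n)) (permutations n)

permutationSetoid : ℕ → Setoid 0ℓ 0ℓ
permutationSetoid n = record
  { Carrier       = Permutation′ n
  ; _≈_           = _≈_
  ; isEquivalence = record
    { refl  = λ _ → refl
    ; sym   = λ p i → sym (p i)
    ; trans = λ p q i → trans (p i) (q i)
    }
  }

private
  insert-cong : ∀ {n j k} (σ τ : Permutation′ n) →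
    j ≡ k → σ ≈ τ → insert zero j σ ≈ insert zero k τ
  insert-cong                 σ τ j≡k σ≈τ zero    = j≡k
  insert-cong {j = j} {k = k} σ τ j≡k σ≈τ (suc i) =
    trans (Perm.insert-punchIn zero j σ i)
      (trans (cong₂ Fin.punchIn j≡k (σ≈τ i)) (sym (Perm.insert-punchIn zero k τ i)))

  insert-injective : ∀ {n j k} (σ τ : Permutation′ n) →
    insert zero j σ ≈ insert zero k τ → j ≡ k × σ ≈ τ
  insert-injective {j = j} {k} σ τ eq = j≡k , λ i →
    Fin.punchIn-injective k _ _
      (trans (cong (λ l → Fin.punchIn l (σ ⟨$⟩ʳ i)) (sym j≡k))
        (trans (sym (Perm.insert-punchIn zero j σ i))
          (trans (eq (suc i)) (Perm.insert-punchIn zero k τ i))))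
    where
    j≡k : j ≡ k
    j≡k = eq zero

permutations-complete : ∀ n (π : Permutation′ n) →
  SetoidMembership._∈_ (permutationSetoid n) π (permutations n)
permutations-complete zero    π = here λ ()
permutations-complete (suc n) π =
  Any.cartesianProductWith⁺ (insert zero) resp
    (∈-allFin (π ⟨$⟩ʳ zero)) (permutations-complete n (remove zero π))
  where
  resp : ∀ {j σ} → π ⟨$⟩ʳ zero ≡ j → remove zero π ≈ σ → π ≈ insert zero j σ
  resp {j} {σ} π0≡j π′≈σ i = trans (sym (Perm.insert-remove zero π i))
    (insert-cong (remove zero π) σ π0≡j π′≈σ i)

permutations-unique : ∀ n → SetoidUnique.Unique (permutationSetoid n) (permutations n)
permutations-unique zero    = All.[] AllPairs.∷ AllPairs.[]
permutations-unique (suc n) = SetoidUniqueₚ.cartesianProductWith⁺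
  (setoid (Fin (suc n))) (permutationSetoid n) (permutationSetoid (suc n))
  (insert zero) (λ {_} {_} {σ} {τ} → insert-injective σ τ)
  (Unique.allFin⁺ (suc n)) (permutations-unique n)

-- The index i : Fin n stands for the position 1 + i.  The first summand is
-- the convention that position n is always a descent.

Descent : ∀ {n} → Permutation′ n → Fin n → Set
Descent {n} π i =
  suc (toℕ i) ≡ n ⊎ ∃ λ j → toℕ j ≡ suc (toℕ i) × (π ⟨$⟩ʳ i) Fin.> (π ⟨$⟩ʳ j)

descent? : ∀ {n} (π : Permutation′ n) i → Dec (Descent π i)
descent? {n} π i = (suc (toℕ i) ℕ.≟ n) ⊎-dec
  Fin.any? λ j → (toℕ j ℕ.≟ suc (toℕ i)) ×-dec ((π ⟨$⟩ʳ j) Fin.<? (π ⟨$⟩ʳ i))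

boundedVecs : ∀ a → ℕ → List (Vec ℕ a)
boundedVecs zero    n = [] ∷ []
boundedVecs (suc a) n = cartesianProductWith _∷_ (upTo (suc n)) (boundedVecs a n)

compositions : ∀ a → ℕ → List (Vec ℕ a)
compositions a n = filter (λ b → Vec.sum b ℕ.≟ n) (boundedVecs a n)

∈-compositions⁺ : ∀ {a n} {b : Vec ℕ a} → Vec.sum b ≡ n → b ∈ compositions a n
∈-compositions⁺ {n = n} {b} eq =
  ∈-filter⁺ (λ b → Vec.sum b ℕ.≟ n) (bounded b (ℕ.≤-reflexive eq)) eq
  where
  bounded : ∀ {a} (b : Vec ℕ a) → Vec.sum b ℕ.≤ n → b ∈ boundedVecs a n
  bounded []      _ = here refl
  bounded (x ∷ b) ≤n = ∈-cartesianProductWith⁺ _∷_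
    (∈-upTo⁺ (ℕ.s≤s (ℕ.m+n≤o⇒m≤o x ≤n)))
    (bounded b (ℕ.m+n≤o⇒n≤o x ≤n))

∈-compositions⁻ : ∀ {a n} {b : Vec ℕ a} → b ∈ compositions a n → Vec.sum b ≡ n
∈-compositions⁻ {a} {n} b∈ =
  proj₂ (∈-filter⁻ (λ b → Vec.sum b ℕ.≟ n) {xs = boundedVecs a n} b∈)

compositions-unique : ∀ a n → Unique (compositions a n)
compositions-unique a n = Unique.filter⁺ (λ b → Vec.sum b ℕ.≟ n) (go a)
  where
  go : ∀ a → Unique (boundedVecs a n)
  go zero    = All.[] AllPairs.∷ AllPairs.[]
  go (suc a) = Unique.cartesianProductWith⁺ _∷_ Vec.∷-injective
    (Unique.upTo⁺ (suc n)) (go a)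

partialSum : ∀ {a} → Vec ℕ a → Fin a → ℕ
partialSum (x ∷ b) zero    = x
partialSum (x ∷ b) (suc m) = x ℕ.+ partialSum b m

∏! : ∀ {a} → Vec ℕ a → ℕ
∏! []      = 1
∏! (x ∷ b) = x ! ℕ.* ∏! b

∏!≢0 : ∀ {a} (b : Vec ℕ a) → ℕ.NonZero (∏! b)
∏!≢0 []      = _
∏!≢0 (x ∷ b) = ℕ.m*n≢0 (x !) (∏! b) {{x ℕ.!≢0}} {{∏!≢0 b}}

multinomial : ∀ {a} → Vec ℕ a → ℕ
multinomial b = (Vec.sum b ! ℕ./ ∏! b) {{∏!≢0 b}}

∏!∣sum! : ∀ {a} (b : Vec ℕ a) → ∏! b ℕ.∣ Vec.sum b !
∏!∣sum! []      = ℕ.∣-refl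
∏!∣sum! (x ∷ b) = ℕ.∣-trans (ℕ.*-monoʳ-∣ (x !) (∏!∣sum! b))
  (subst (λ y → y ! ℕ.* Vec.sum b ! ℕ.∣ (x ℕ.+ Vec.sum b) !)
    (ℕ.m+n∸n≡m x (Vec.sum b))
    ([n∸k]!k!∣n! (ℕ.m≤n+m (Vec.sum b) x)))

multinomial≢0 : ∀ {a} (b : Vec ℕ a) → ℕ.NonZero (multinomial b)
multinomial≢0 b = ℕ.>-nonZero
  (ℕ.m≥n⇒m/n>0 {{∏!≢0 b}} (ℕ.∣⇒≤ {{Vec.sum b ℕ.!≢0}} (∏!∣sum! b)))

Measure : ℕ → Set
Measure n = Permutation′ n → ℝ

uniform : ∀ n → Measure n
uniform n π = fromℚ ((+ 1 ℚ./ (n !)) {{n ℕ.!≢0}})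

pointMass : ∀ {n} → Permutation′ n → Measure n
pointMass σ π = if does (Fin.all? λ i → (σ ⟨$⟩ʳ i) Fin.≟ (π ⟨$⟩ʳ i)) then 1ℝ else 0ℝ

DescentsWithin : ∀ {n a} → Vec ℕ a → Permutation′ n → Set
DescentsWithin b π = ∀ i → Descent π i → ∃ λ m → suc (toℕ i) ≡ partialSum b m

descentsWithin? : ∀ {n a} (b : Vec ℕ a) (π : Permutation′ n) → Dec (DescentsWithin b π)
descentsWithin? b π = Fin.all? λ i →
  descent? π i →-dec Fin.any? λ m → suc (toℕ i) ℕ.≟ partialSum b m

-- The law of the second stage of the shuffle, given the composition b chosen
-- in the first: each of the multinomial b many permutations whose inverse has
-- its descents within the partial sums of b is equally likely.

givenCuts : ∀ {n a} → Vec ℕ a → Measure n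
givenCuts b π =
  if does (descentsWithin? b (flip π))
  then fromℚ ((+ 1 ℚ./ multinomial b) {{multinomial≢0 b}})
  else 0ℝ

shuffle : ∀ n {a} → (Fin a → ℝ) → Measure n
shuffle n {a} p π = Σ[ b ∈ compositions a n ]
  (fromℕ (multinomial b) * product (λ i → p i ^ lookup b i)) * givenCuts b π

-- The law of the product στ for independent σ ∼ P and τ ∼ Q.  As _∘ₚ_
-- composes in diagrammatic order, π ∘ₚ flip σ is σ⁻¹π.

infixl 7 _⋆_
_⋆_ : ∀ {n} → Measure n → Measure n → Measure n
(_⋆_ {n} P Q) π = Σ[ σ ∈ permutations n ] P σ * Q (π ∘ₚ flip σ)

infixl 8 _⋆^_
_⋆^_ : ∀ {n} → Measure n → ℕ → Measure n
P ⋆^ zero  = pointMass Perm.id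
P ⋆^ suc k = P ⋆ (P ⋆^ k)

totalVariation : ∀ {n} → Measure n → Measure n → ℝ
totalVariation {n} P Q = fromℚ ½ * (Σ[ π ∈ permutations n ] ∣ P π - Q π ∣)

{-# OPTIONS --safe #-}
module Submission where

open import Defs using (permutations; permutationSetoid; permutations-complete; permutations-unique)
open import Defs using (Descent; DescentsWithin; descentsWithin?; partialSum)
open import Defs using (compositions; compositions-unique; ∈-compositions⁺; ∈-compositions⁻)
import Algebra.Properties.CommutativeMonoid.Sum as CommutativeMonoidSum
open import Data.Bool.Base using (if_then_else_)
import Data.Integer.Base as ℤ
import Data.Integer.Properties as ℤ
open import Data.Nat.Base as ℕ using (ℕ; zero; suc; z≤n; s≤s; s≤s⁻¹; _!)
import Data.Nat.Properties as ℕ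
open import Data.Nat.Combinatorics using (_C_; nC1≡n; nCk+nC[k+1]≡[n+1]C[k+1])
open import Data.Product.Base using (∃; _×_; _,_; proj₁; proj₂)
open import Data.Sum.Base using (_⊎_; inj₁; inj₂)
open import Data.Fin.Base as Fin using (Fin; zero; suc; toℕ; fromℕ<; punchIn; combine; remQuot)
import Data.Fin.Properties as Fin
open import Data.Fin.Permutation as Perm
  using (Permutation′; _⟨$⟩ʳ_; _⟨$⟩ˡ_; _∘ₚ_; flip; insert)
open import Data.List.Base as List using (List; []; _∷_; _++_; allFin; cartesianProductWith)
open import Data.List.Membership.Propositional using (_∈_)
open import Data.List.Membership.Propositional.Properties
  using (∈-cartesianProductWith⁺; ∈-cartesianProduct⁺; ∈-allFin)
import Data.List.Membership.Setoid as SetoidMembership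
open import Data.List.Relation.Unary.All as All using (All; []; _∷_)
open import Data.List.Relation.Unary.AllPairs using ([]; _∷_)
open import Data.List.Relation.Unary.Any using (here; there)
open import Data.List.Relation.Unary.Unique.Propositional using (Unique)
import Data.List.Relation.Unary.Unique.Propositional.Properties as Unique
import Data.List.Relation.Unary.Unique.Setoid as SetoidUnique
open import Data.Rational.Base as ℚ using (ℚ; 0ℚ; 1ℚ; ½)
import Data.Rational.Properties as ℚ
import Data.Rational.Unnormalised.Base as ℚᵘ
import Data.Rational.Unnormalised.Properties as ℚᵘ
open import Data.Rational.Solver using (module +-*-Solver)
open import Data.Vec.Base as Vec using (Vec; []; _∷_; lookup; tabulate)
import Data.Vec.Properties as Vec
open import Function.Base using (_∘_; id)
open import Level using (0ℓ)
open import Relation.Binary.Bundles using (Setoid)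
open import Relation.Binary.Definitions using (tri<; tri≈; tri>)
open import Relation.Binary.PropositionalEquality
  using (_≡_; _≢_; _≗_; refl; sym; trans; cong; cong₂; subst; subst₂; setoid; module ≡-Reasoning)
open import Relation.Nullary.Decidable
  using (Dec; does; yes; no; ¬?; dec-true; dec-false; _×-dec_; _⊎-dec_; _→-dec_)
open import Relation.Nullary.Negation using (¬_; contradiction)

-- The shuffle is the law of the standardization of a random word of n
-- independent letters with law p (position i goes to the rank of its letter,
-- ties broken from left to right), grouped by the numbers b of letters of each
-- kind.  Standardizing a word of pairs ordered lexicographically composes the
-- two standardizations, so the k-th convolution power belongs to the alphabet
-- of k-tuples with the product law.  Words with distinct letters contribute
-- equally to all permutations; the distance to uniform is thus at most the
-- probability that two of the n letters coincide, which is at most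
-- (n choose 2) times the probability (Σ pᵢ²)ᵏ that two given letters do.
--
-- A real is a sequence of rationals whose terms need not form a probability
-- vector.  The bound is therefore proved for arbitrary rational weights q, with
-- the corrections (Σ |qᵢ|)ᵏ⁽ⁿ⁻²⁾ and |(Σ qᵢ)ᵏⁿ − 1|, which tend to 1 and 0.

-- Pairs compose because tie-breaking is stable: sorting by the minor letter and then stably by the
-- major one is sorting lexicographically. The first sort rearranges the major word, but a product
-- weight is invariant under rearrangement, so the two words stay independent. The constant 1 in
-- front of the collision mass E arises as follows. The law is a part constant on all permutations
-- (distinct letters) plus an error of total absolute mass at most E. Both parts together carry the
-- total mass of the law, so the constant part, summed over all permutations, misses the uniform law
-- by at most E plus the defect of that mass from 1. E is thus counted twice, and the factor ½ of
-- total variation cancels this. The exponent k(n-2) counts the letters outside a colliding pair: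
-- their absolute weights are summed without restriction. Signed weights also explain why E is
-- computed with absolute values, while the mass defect uses the plain sum.

-- Finite sums of rationals over lists, indicators, and reindexing along relations.

module FiniteSums where

  open import Data.Rational.Base using (_+_; _*_; ∣_∣; _≤_)
  open +-*-Solver using (solve; _:=_; _:+_)

  private variable
    A B : Set
    P Q : Set

  𝟙 : Dec P → ℚ
  𝟙 P? = if does P? then 1ℚ else 0ℚ

  𝟙-true : (P? : Dec P) → P → 𝟙 P? ≡ 1ℚ
  𝟙-true P? p rewrite dec-true P? p = refl

  𝟙-false : (P? : Dec P) → ¬ P → 𝟙 P? ≡ 0ℚ
  𝟙-false P? ¬p rewrite dec-false P? ¬p = refl

  𝟙-cong : (P? : Dec P) (Q? : Dec Q) → (P → Q) → (Q → P) → 𝟙 P? ≡ 𝟙 Q?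
  𝟙-cong (yes p) Q? f g = sym (𝟙-true Q? (f p))
  𝟙-cong (no ¬p) Q? f g = sym (𝟙-false Q? (¬p ∘ g))

  0≤𝟙 : (P? : Dec P) → 0ℚ ≤ 𝟙 P?
  0≤𝟙 (yes _) = ℚ.nonNegative⁻¹ 1ℚ
  0≤𝟙 (no  _) = ℚ.≤-refl

  𝟙≢0 : (P? : Dec P) → 𝟙 P? ≢ 0ℚ → P
  𝟙≢0 (yes p) _ = p
  𝟙≢0 (no ¬p) ≢0 = contradiction refl ≢0

  *𝟙≢0 : ∀ c (P? : Dec P) → c * 𝟙 P? ≢ 0ℚ → P
  *𝟙≢0 c P? ≢0 = 𝟙≢0 P? λ ≡0 → ≢0 (trans (cong (c *_) ≡0) (ℚ.*-zeroʳ c))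

  *-monoˡ-≤ : ∀ {x y} c → 0ℚ ≤ c → x ≤ y → c * x ≤ c * y
  *-monoˡ-≤ c 0≤c = ℚ.*-monoˡ-≤-nonNeg c {{ℚ.nonNegative 0≤c}}

  0≤* : ∀ {x y} → 0ℚ ≤ x → 0ℚ ≤ y → 0ℚ ≤ x * y
  0≤* {x} {y} 0≤x 0≤y = subst (_≤ x * y) (ℚ.*-zeroʳ x) (*-monoˡ-≤ x 0≤x 0≤y)

  ∑ : List A → (A → ℚ) → ℚ
  ∑ []       f = 0ℚ
  ∑ (x ∷ xs) f = f x + ∑ xs f

  syntax ∑ xs (λ x → e) = ∑[ x ∈ xs ] e

  infix 5 ∑

  ∑-cong-∈ : ∀ (xs : List A) {f g} → (∀ {x} → x ∈ xs → f x ≡ g x) → ∑ xs f ≡ ∑ xs g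
  ∑-cong-∈ []       f≡g = refl
  ∑-cong-∈ (x ∷ xs) f≡g = cong₂ _+_ (f≡g (here refl)) (∑-cong-∈ xs (f≡g ∘ there))

  ∑-cong : ∀ (xs : List A) {f g} → (∀ x → f x ≡ g x) → ∑ xs f ≡ ∑ xs g
  ∑-cong xs f≡g = ∑-cong-∈ xs λ {x} _ → f≡g x

  ∑-zero : ∀ (xs : List A) → ∑ xs (λ _ → 0ℚ) ≡ 0ℚ
  ∑-zero []       = refl
  ∑-zero (x ∷ xs) = trans (ℚ.+-identityˡ _) (∑-zero xs)

  ∑-+ : ∀ (xs : List A) f g → ∑ xs (λ x → f x + g x) ≡ ∑ xs f + ∑ xs g
  ∑-+ []       f g = refl
  ∑-+ (x ∷ xs) f g = trans (cong (f x + g x +_) (∑-+ xs f g))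
    (solve 4 (λ a b c d → (a :+ b) :+ (c :+ d) := (a :+ c) :+ (b :+ d)) refl
      (f x) (g x) (∑ xs f) (∑ xs g))

  ∑-*ˡ : ∀ (xs : List A) c f → ∑ xs (λ x → c * f x) ≡ c * ∑ xs f
  ∑-*ˡ []       c f = sym (ℚ.*-zeroʳ c)
  ∑-*ˡ (x ∷ xs) c f = trans (cong (c * f x +_) (∑-*ˡ xs c f))
    (sym (ℚ.*-distribˡ-+ c (f x) (∑ xs f)))

  ∑-*ʳ : ∀ (xs : List A) c f → ∑ xs (λ x → f x * c) ≡ ∑ xs f * c
  ∑-*ʳ xs c f = trans (∑-cong xs λ x → ℚ.*-comm (f x) c)
    (trans (∑-*ˡ xs c f) (ℚ.*-comm c (∑ xs f)))

  ∑-swap : ∀ (xs : List A) (ys : List B) (f : A → B → ℚ) →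
    ∑[ x ∈ xs ] ∑[ y ∈ ys ] f x y ≡ ∑[ y ∈ ys ] ∑[ x ∈ xs ] f x y
  ∑-swap []       ys f = sym (∑-zero ys)
  ∑-swap (x ∷ xs) ys f = trans (cong (∑ ys (f x) +_) (∑-swap xs ys f))
    (sym (∑-+ ys (f x) λ y → ∑ xs λ x → f x y))

  ∑-product : ∀ (xs : List A) (ys : List B) f g →
    ∑[ x ∈ xs ] ∑[ y ∈ ys ] f x * g y ≡ ∑ xs f * ∑ ys g
  ∑-product xs ys f g = trans (∑-cong xs λ x → ∑-*ˡ ys (f x) g) (∑-*ʳ xs (∑ ys g) f)

  ∑-++ : ∀ (xs ys : List A) f → ∑ (xs ++ ys) f ≡ ∑ xs f + ∑ ys f
  ∑-++ []       ys f = sym (ℚ.+-identityˡ _)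
  ∑-++ (x ∷ xs) ys f = trans (cong (f x +_) (∑-++ xs ys f))
    (sym (ℚ.+-assoc (f x) (∑ xs f) (∑ ys f)))

  ∑-map : ∀ (h : A → B) xs f → ∑ (List.map h xs) f ≡ ∑ xs (f ∘ h)
  ∑-map h []       f = refl
  ∑-map h (x ∷ xs) f = cong (f (h x) +_) (∑-map h xs f)

  ∑-cartesianProductWith : ∀ {C : Set} (h : A → B → C) xs ys f →
    ∑ (cartesianProductWith h xs ys) f ≡ ∑[ x ∈ xs ] ∑[ y ∈ ys ] f (h x y)
  ∑-cartesianProductWith h []       ys f = refl
  ∑-cartesianProductWith h (x ∷ xs) ys f =
    trans (∑-++ (List.map (h x) ys) _ f)
      (cong₂ _+_ (∑-map (h x) ys f) (∑-cartesianProductWith h xs ys f))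

  ∑-mono : ∀ (xs : List A) {f g} → (∀ x → f x ≤ g x) → ∑ xs f ≤ ∑ xs g
  ∑-mono []       f≤g = ℚ.≤-refl
  ∑-mono (x ∷ xs) f≤g = ℚ.+-mono-≤ (f≤g x) (∑-mono xs f≤g)

  ∑-nonNeg : ∀ (xs : List A) {f} → (∀ x → 0ℚ ≤ f x) → 0ℚ ≤ ∑ xs f
  ∑-nonNeg xs {f} 0≤f = subst (_≤ ∑ xs f) (∑-zero xs) (∑-mono xs 0≤f)

  ∣∑∣≤∑∣∣ : ∀ (xs : List A) f → ∣ ∑ xs f ∣ ≤ ∑[ x ∈ xs ] ∣ f x ∣
  ∣∑∣≤∑∣∣ []       f = ℚ.≤-refl
  ∣∑∣≤∑∣∣ (x ∷ xs) f = ℚ.≤-trans (ℚ.∣p+q∣≤∣p∣+∣q∣ (f x) (∑ xs f))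
    (ℚ.+-monoʳ-≤ ∣ f x ∣ (∣∑∣≤∑∣∣ xs f))

  module _ (S : Setoid 0ℓ 0ℓ) where

    open Setoid S using (_≈_; _≉_) renaming (Carrier to X; sym to ≈-sym; trans to ≈-trans)
    open SetoidMembership S using () renaming (_∈_ to _∈ₛ_)

    ∑-vanishing : ∀ {x : X} {xs f} → All (x ≉_) xs → (∀ {y} → y ≉ x → f y ≡ 0ℚ) →
      ∑ xs f ≡ 0ℚ
    ∑-vanishing []           f≡0 = refl
    ∑-vanishing (x≉y ∷ x≉ys) f≡0 =
      cong₂ _+_ (f≡0 (x≉y ∘ ≈-sym)) (∑-vanishing x≉ys f≡0)

    -- Stated over a setoid because the list of permutations is complete and free of repetition only
    -- up to pointwise equality.
    ∑-single : ∀ {x : X} {xs f c} → SetoidUnique.Unique S xs → x ∈ₛ xs →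
      (∀ {y} → y ≈ x → f y ≡ c) → (∀ {y} → y ≉ x → f y ≡ 0ℚ) → ∑ xs f ≡ c
    ∑-single {c = c} (y≉ys ∷ _) (here x≈y) f≡c f≡0 =
      trans (cong₂ _+_ (f≡c (≈-sym x≈y))
        (∑-vanishing y≉ys λ z≉y → f≡0 λ z≈x → z≉y (≈-trans z≈x x≈y)))
        (ℚ.+-identityʳ c)
    ∑-single {x} {f = f} {c} (y≉ys ∷ ys!) (there x∈ys) f≡c f≡0 =
      trans (cong₂ _+_ (f≡0 λ y≈x → apart y≉ys x∈ys y≈x) (∑-single ys! x∈ys f≡c f≡0))
        (ℚ.+-identityˡ c)
      where
      apart : ∀ {y ys} → All (y ≉_) ys → x ∈ₛ ys → ¬ y ≈ x
      apart (y≉z ∷ _) (here x≈z)  y≈x = y≉z (≈-trans y≈x x≈z)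
      apart (_ ∷ y≉)  (there x∈)  y≈x = apart y≉ x∈ y≈x

  -- A related index is demanded only when `c` is nonzero. This lets `∑-match` pair up supports, so
  -- that terms equal to zero may remain unmatched.
  ∑-fibre : ∀ {R : B → Set} (R? : ∀ y → Dec (R y)) {ys : List B} {c} → Unique ys →
    (∀ {y z} → y ∈ ys → z ∈ ys → R y → R z → y ≡ z) →
    (c ≢ 0ℚ → ∃ λ y → y ∈ ys × R y) →
    ∑[ y ∈ ys ] 𝟙 (R? y) * c ≡ c
  ∑-fibre {R = R} R? {ys} {c} ys! R-unique exists with c ℚ.≟ 0ℚ
  ... | yes refl = trans (∑-cong ys λ y → ℚ.*-zeroʳ (𝟙 (R? y))) (∑-zero ys)
  ... | no c≢0 with exists c≢0
  ...   | y₀ , y₀∈ys , Ry₀ = begin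
    ∑[ y ∈ ys ] 𝟙 (R? y) * c            ≡⟨ ∑-*ʳ ys c (λ y → 𝟙 (R? y)) ⟩
    (∑[ y ∈ ys ] 𝟙 (R? y)) * c          ≡⟨ cong (_* c) (count ys! y₀∈ys R-unique) ⟩
    1ℚ * c                              ≡⟨ ℚ.*-identityˡ c ⟩
    c                                   ∎
    where
    open ≡-Reasoning
    none : ∀ ys → (∀ {y} → y ∈ ys → ¬ R y) → ∑[ y ∈ ys ] 𝟙 (R? y) ≡ 0ℚ
    none ys ¬R = trans (∑-cong-∈ ys λ {y} y∈ → 𝟙-false (R? y) (¬R y∈)) (∑-zero ys)
    count : ∀ {ys} → Unique ys → y₀ ∈ ys →
      (∀ {y z} → y ∈ ys → z ∈ ys → R y → R z → y ≡ z) → ∑[ y ∈ ys ] 𝟙 (R? y) ≡ 1ℚ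
    count {y ∷ ys} (y≢ ∷ _) (here refl) unique =
      trans (cong₂ _+_ (𝟙-true (R? y₀) Ry₀) (none ys λ z∈ Rz →
        All.lookup y≢ z∈ (unique (here refl) (there z∈) Ry₀ Rz)))
        (ℚ.+-identityʳ 1ℚ)
    count {y ∷ ys} (y≢ ∷ ys!) (there y₀∈) unique =
      trans (cong₂ _+_ (𝟙-false (R? y) λ Ry →
        All.lookup y≢ y₀∈ (unique (here refl) (there y₀∈) Ry Ry₀))
        (count ys! y₀∈ λ y∈ z∈ → unique (there y∈) (there z∈)))
        (ℚ.+-identityˡ 1ℚ)

  -- The relation R is a bijection between the supports of f and g.
  ∑-match : ∀ {R : A → B → Set} (R? : ∀ x y → Dec (R x y)) {xs ys f g} →
    Unique xs → Unique ys →
    (∀ {x y} → x ∈ xs → y ∈ ys → R x y → f x ≡ g y) →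
    (∀ {x y z} → x ∈ xs → y ∈ ys → z ∈ ys → R x y → R x z → y ≡ z) →
    (∀ {x y z} → x ∈ xs → y ∈ xs → z ∈ ys → R x z → R y z → x ≡ y) →
    (∀ {x} → x ∈ xs → f x ≢ 0ℚ → ∃ λ y → y ∈ ys × R x y) →
    (∀ {y} → y ∈ ys → g y ≢ 0ℚ → ∃ λ x → x ∈ xs × R x y) →
    ∑ xs f ≡ ∑ ys g
  ∑-match {R = R} R? {xs} {ys} {f} {g} xs! ys! f≡g functional injective total surjective = begin
    ∑[ x ∈ xs ] f x
      ≡⟨ ∑-cong-∈ xs (λ {x} x∈ → sym (∑-fibre (R? x) ys! (functional x∈) (total x∈))) ⟩
    ∑[ x ∈ xs ] ∑[ y ∈ ys ] 𝟙 (R? x y) * f x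
      ≡⟨ ∑-cong-∈ xs (λ x∈ → ∑-cong-∈ ys (λ y∈ → transfer x∈ y∈)) ⟩
    ∑[ x ∈ xs ] ∑[ y ∈ ys ] 𝟙 (R? x y) * g y
      ≡⟨ ∑-swap xs ys (λ x y → 𝟙 (R? x y) * g y) ⟩
    ∑[ y ∈ ys ] ∑[ x ∈ xs ] 𝟙 (R? x y) * g y
      ≡⟨ ∑-cong-∈ ys (λ {y} y∈ → ∑-fibre (λ x → R? x y) xs!
           (λ x∈ z∈ → injective x∈ z∈ y∈) (surjective y∈)) ⟩
    ∑[ y ∈ ys ] g y ∎
    where
    open ≡-Reasoning
    transfer : ∀ {x y} → x ∈ xs → y ∈ ys → 𝟙 (R? x y) * f x ≡ 𝟙 (R? x y) * g y
    transfer {x} {y} x∈ y∈ with R? x y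
    ... | yes Rxy = cong (1ℚ *_) (f≡g x∈ y∈ Rxy)
    ... | no  _   = trans (ℚ.*-zeroˡ (f x)) (sym (ℚ.*-zeroˡ (g y)))

open FiniteSums

-- Standardization of words: existence, uniqueness, distinct letters, and words of pairs.

module Standardization where

  open import Data.Fin.Permutation using (_≈_)
  open import Data.Fin.Base using (_<_; _≤_)

  private variable
    n a c : ℕ

  StrictlyMonotone : (Fin n → Fin n) → Set
  StrictlyMonotone f = ∀ {i j} → i < j → f i < f j

  strictlyMonotone⇒inflationary : ∀ {f : Fin n → Fin n} → StrictlyMonotone f → ∀ i → i ≤ f i
  strictlyMonotone⇒inflationary {n} {f} f-mono i = go (toℕ i) i refl
    where
    go : ∀ k i → toℕ i ≡ k → k ℕ.≤ toℕ (f i)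
    go zero    i _    = z≤n
    go (suc k) i i≡sk = ℕ.≤-<-trans (go k j (Fin.toℕ-fromℕ< k<n)) (f-mono j<i)
      where
      k<i : k ℕ.< toℕ i
      k<i = ℕ.≤-reflexive (sym i≡sk)
      k<n : k ℕ.< n
      k<n = ℕ.<-trans k<i (Fin.toℕ<n i)
      j : Fin n
      j = fromℕ< k<n
      j<i : j < i
      j<i = subst (ℕ._< toℕ i) (sym (Fin.toℕ-fromℕ< k<n)) k<i

  -- π standardizes u when π i is the rank of the position i by its letter u i,
  -- ties being broken from left to right.

  Precedes : (Fin n → Fin a) → Fin n → Fin n → Set
  Precedes u i j = u i < u j ⊎ u i ≡ u j × i < j

  precedes? : ∀ (u : Fin n → Fin a) i j → Dec (Precedes u i j)
  precedes? u i j = (u i Fin.<? u j) ⊎-dec ((u i Fin.≟ u j) ×-dec (i Fin.<? j))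

  precedes-total : ∀ (u : Fin n → Fin a) i j → i ≢ j → Precedes u i j ⊎ Precedes u j i
  precedes-total u i j i≢j with Fin.<-cmp (u i) (u j) | Fin.<-cmp i j
  ... | tri< ui<uj _ _ | _              = inj₁ (inj₁ ui<uj)
  ... | tri> _ _ ui>uj | _              = inj₂ (inj₁ ui>uj)
  ... | tri≈ _ ui≡uj _ | tri< i<j _ _   = inj₁ (inj₂ (ui≡uj , i<j))
  ... | tri≈ _ ui≡uj _ | tri≈ _ i≡j _   = contradiction i≡j i≢j
  ... | tri≈ _ ui≡uj _ | tri> _ _ i>j   = inj₂ (inj₂ (sym ui≡uj , i>j))

  precedes⇒≤ : ∀ (u : Fin n → Fin a) {i j} → Precedes u i j → u i ≤ u j
  precedes⇒≤ u (inj₁ ui<uj)       = ℕ.<⇒≤ ui<uj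
  precedes⇒≤ u (inj₂ (ui≡uj , _)) = Fin.≤-reflexive ui≡uj

  Standardizes : (Fin n → Fin a) → Permutation′ n → Set
  Standardizes u π = ∀ i j → Precedes u i j → π ⟨$⟩ʳ i < π ⟨$⟩ʳ j

  standardizes? : ∀ (u : Fin n → Fin a) π → Dec (Standardizes u π)
  standardizes? u π = Fin.all? λ i → Fin.all? λ j →
    precedes? u i j →-dec ((π ⟨$⟩ʳ i) Fin.<? (π ⟨$⟩ʳ j))

  standardizes-resp-≗ : ∀ {u v : Fin n → Fin a} π → u ≗ v → Standardizes u π → Standardizes v π
  standardizes-resp-≗ π u≗v st i j (inj₁ vi<vj) =
    st i j (inj₁ (subst₂ _<_ (sym (u≗v i)) (sym (u≗v j)) vi<vj))
  standardizes-resp-≗ π u≗v st i j (inj₂ (vi≡vj , i<j)) =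
    st i j (inj₂ (trans (u≗v i) (trans vi≡vj (sym (u≗v j))) , i<j))

  standardizes-resp-≈ : ∀ (u : Fin n → Fin a) {π σ} → π ≈ σ → Standardizes u π → Standardizes u σ
  standardizes-resp-≈ u π≈σ st i j i≺j = subst₂ _<_ (π≈σ i) (π≈σ j) (st i j i≺j)

  -- One implication suffices as the definition of `Standardizes`: precedence is total on distinct
  -- positions, and the opposite precedence would give the opposite inequality of ranks.
  standardizes⁻¹ : ∀ (u : Fin n → Fin a) π → Standardizes u π →
    ∀ i j → π ⟨$⟩ʳ i < π ⟨$⟩ʳ j → Precedes u i j
  standardizes⁻¹ u π st i j πi<πj with i Fin.≟ j
  ... | yes refl = contradiction πi<πj (ℕ.<-irrefl refl)
  ... | no  i≢j with precedes-total u i j i≢j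
  ...   | inj₁ i≺j = i≺j
  ...   | inj₂ j≺i = contradiction (st j i j≺i) (ℕ.<-asym πi<πj)

  standardizes⇒monotone : ∀ (u : Fin n → Fin a) π → Standardizes u π →
    ∀ {x y} → x ≤ y → u (π ⟨$⟩ˡ x) ≤ u (π ⟨$⟩ˡ y)
  standardizes⇒monotone u π st {x} {y} x≤y with ℕ.m≤n⇒m<n∨m≡n x≤y
  ... | inj₂ x≡y = Fin.≤-reflexive (cong (λ z → u (π ⟨$⟩ˡ z)) (Fin.toℕ-injective x≡y))
  ... | inj₁ x<y = precedes⇒≤ u (standardizes⁻¹ u π st _ _
    (subst₂ _<_ (sym (Perm.inverseʳ π)) (sym (Perm.inverseʳ π)) x<y))

  private
    -- Both permutations order the positions by the same precedence, so σ after the inverse of π is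
    -- strictly increasing on ranks, hence inflationary. Exchanging π and σ then yields uniqueness.
    standardizes⇒≤ : ∀ (u : Fin n → Fin a) π σ → Standardizes u π → Standardizes u σ →
      ∀ i → π ⟨$⟩ʳ i ≤ σ ⟨$⟩ʳ i
    standardizes⇒≤ u π σ stπ stσ i =
      subst (λ z → π ⟨$⟩ʳ i ≤ σ ⟨$⟩ʳ z) (Perm.inverseˡ π)
        (strictlyMonotone⇒inflationary {f = λ x → σ ⟨$⟩ʳ (π ⟨$⟩ˡ x)}
          (λ x<y → stσ _ _ (standardizes⁻¹ u π stπ _ _
            (subst₂ _<_ (sym (Perm.inverseʳ π)) (sym (Perm.inverseʳ π)) x<y)))
          (π ⟨$⟩ʳ i))

  standardizes-unique : ∀ (u : Fin n → Fin a) π σ → Standardizes u π → Standardizes u σ → π ≈ σ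
  standardizes-unique u π σ stπ stσ i =
    Fin.≤-antisym (standardizes⇒≤ u π σ stπ stσ i) (standardizes⇒≤ u σ π stσ stπ i)

  -- The threshold `t` of a decidable down-closed set. Letters listed by rank increase weakly, so
  -- bounding a letter from above gives such a set; thresholds serve as the insertion rank in
  -- `standardization` and as the cuts in `standardizes⇒cutBy`.
  initialSegment : ∀ {Q : Fin n → Set} → (∀ i → Dec (Q i)) → (∀ {i j} → i ≤ j → Q j → Q i) →
    ∃ λ t → t ℕ.≤ n × (∀ i → Q i → toℕ i ℕ.< t) × (∀ i → toℕ i ℕ.< t → Q i)
  initialSegment {zero}  Q? down = 0 , z≤n , (λ ()) , λ ()
  initialSegment {suc n} Q? down with Q? zero
  ... | no ¬Q0 = 0 , z≤n , (λ i Qi → contradiction (down {zero} z≤n Qi) ¬Q0) , λ _ ()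
  ... | yes Q0 with initialSegment (Q? ∘ suc) (λ {i} {j} i≤j → down {suc i} {suc j} (s≤s i≤j))
  ...   | t , t≤n , to , from = suc t , s≤s t≤n
    , (λ { zero _ → s≤s z≤n ; (suc i) Qi → s≤s (to i Qi) })
    , (λ { zero _ → Q0 ; (suc i) i<t → from i (s≤s⁻¹ i<t) })

  private
    punchIn-mono-< : ∀ (k : Fin (suc n)) {i j} → i < j → punchIn k i < punchIn k j
    punchIn-mono-< k {i} {j} i<j = ℕ.≰⇒> λ j≤i →
      ℕ.<⇒≱ i<j (Fin.punchIn-cancel-≤ k j i j≤i)

    punchIn-> : ∀ (k : Fin (suc n)) {j} → toℕ k ℕ.≤ toℕ j → k < punchIn k j
    punchIn-> zero                _         = s≤s z≤n
    punchIn-> (suc k) {suc j} (s≤s k≤j) = s≤s (punchIn-> k k≤j)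

    punchIn-< : ∀ (k : Fin (suc n)) {j} → toℕ j ℕ.< toℕ k → punchIn k j < k
    punchIn-< (suc k) {zero}  _         = s≤s z≤n
    punchIn-< (suc k) {suc j} (s≤s j<k) = s≤s (punchIn-< k j<k)

  -- Insertion sort. Position zero receives as its rank the number of later letters strictly smaller
  -- than its own; the inequality is strict because position zero comes before every later position
  -- with the same letter.
  standardization : ∀ (u : Fin n → Fin a) → ∃ λ π → Standardizes u π
  standardization {zero}  u = Perm.id , λ ()
  standardization {suc n} u with standardization (u ∘ suc)
  ... | σ , stσ with initialSegment (λ l → u (suc (σ ⟨$⟩ˡ l)) Fin.<? u zero)
                       (λ i≤j → ℕ.≤-<-trans (standardizes⇒monotone (u ∘ suc) σ stσ i≤j))
  ... | t , t≤n , to , from = insert zero k σ , st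
    where
    k : Fin (suc n)
    k = fromℕ< (s≤s t≤n)
    k≡t : toℕ k ≡ t
    k≡t = Fin.toℕ-fromℕ< (s≤s t≤n)
    below : ∀ j → toℕ (σ ⟨$⟩ʳ j) ℕ.< t → u (suc j) < u zero
    below j σj<t = subst (λ i → u (suc i) < u zero) (Perm.inverseˡ σ) (from _ σj<t)
    above : ∀ j → u (suc j) < u zero → toℕ (σ ⟨$⟩ʳ j) ℕ.< t
    above j uj<u0 = to _ (subst (λ i → u (suc i) < u zero) (sym (Perm.inverseˡ σ)) uj<u0)
    at-suc : ∀ j → insert zero k σ ⟨$⟩ʳ suc j ≡ punchIn k (σ ⟨$⟩ʳ j)
    at-suc = Perm.insert-punchIn zero k σ
    st : Standardizes u (insert zero k σ)
    st zero    zero    (inj₁ u0<u0) = contradiction u0<u0 (ℕ.<-irrefl refl)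
    st zero    (suc j) 0≺j = subst (k <_) (sym (at-suc j)) (punchIn-> k
      (subst (ℕ._≤ _) (sym k≡t) (ℕ.≮⇒≥ λ σj<t →
        ℕ.<⇒≱ (below j σj<t) (precedes⇒≤ u 0≺j))))
    st (suc i) zero    (inj₁ ui<u0) = subst (_< k) (sym (at-suc i))
      (punchIn-< k (subst (_ ℕ.<_) (sym k≡t) (above i ui<u0)))
    st (suc i) (suc j) i≺j = subst₂ _<_ (sym (at-suc i)) (sym (at-suc j))
      (punchIn-mono-< k (stσ i j (shift i≺j)))
      where
      shift : Precedes u (suc i) (suc j) → Precedes (u ∘ suc) i j
      shift (inj₁ ui<uj)         = inj₁ ui<uj
      shift (inj₂ (ui≡uj , i<j)) = inj₂ (ui≡uj , s≤s⁻¹ i<j)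

  standardizes-constant : ∀ (u : Fin n → Fin a) → (∀ i j → u i ≡ u j) → Standardizes u Perm.id
  standardizes-constant u const i j (inj₁ ui<uj)      =
    contradiction (cong toℕ (const i j)) (ℕ.<⇒≢ ui<uj)
  standardizes-constant u const i j (inj₂ (_ , i<j)) = i<j

  Distinct : (Fin n → Fin a) → Set
  Distinct u = ∀ i j → u i ≡ u j → i ≡ j

  distinct? : ∀ (u : Fin n → Fin a) → Dec (Distinct u)
  distinct? u = Fin.all? λ i → Fin.all? λ j → (u i Fin.≟ u j) →-dec (i Fin.≟ j)

  distinct-rearrange : ∀ (u : Fin n → Fin a) (π : Permutation′ n) →
    Distinct u → Distinct (u ∘ (π ⟨$⟩ʳ_))
  distinct-rearrange u π d i j eq = trans (sym (Perm.inverseˡ π))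
    (trans (cong (π ⟨$⟩ˡ_) (d _ _ eq)) (Perm.inverseˡ π))

  -- Without ties, precedence depends on the letters alone and is carried along by any
  -- rearrangement. With ties this would fail, since rearranging changes which of two equal letters
  -- comes first.
  distinct-standardizes : ∀ (u : Fin n → Fin a) (π : Permutation′ n) → Distinct u →
    Standardizes u Perm.id → Standardizes (u ∘ (π ⟨$⟩ʳ_)) π
  distinct-standardizes u π d st i j (inj₁ ui<uj)         = st _ _ (inj₁ ui<uj)
  distinct-standardizes u π d st i j (inj₂ (ui≡uj , i<j)) =
    contradiction (cong toℕ (distinct-rearrange u π d i j ui≡uj)) (ℕ.<⇒≢ i<j)

  distinct-standardizes⁻¹ : ∀ (u : Fin n → Fin a) (π : Permutation′ n) → Distinct u →
    Standardizes (u ∘ (π ⟨$⟩ʳ_)) π → Standardizes u Perm.id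
  distinct-standardizes⁻¹ u π d st x y (inj₂ (ux≡uy , x<y)) =
    contradiction (cong toℕ (d x y ux≡uy)) (ℕ.<⇒≢ x<y)
  distinct-standardizes⁻¹ u π d st x y (inj₁ ux<uy) =
    subst₂ _<_ (Perm.inverseʳ π) (Perm.inverseʳ π) (st _ _ (inj₁
      (subst₂ (λ x y → u x < u y) (sym (Perm.inverseʳ π)) (sym (Perm.inverseʳ π)) ux<uy)))

  pairing : (Fin n → Fin a) → (Fin n → Fin c) → Fin n → Fin (a ℕ.* c)
  pairing u v i = combine (u i) (v i)

  combine-monoʳ-< : ∀ (x : Fin a) {y z : Fin c} → y < z → combine x y < combine x z
  combine-monoʳ-< {c = c} x {y} {z} y<z = subst₂ ℕ._<_
    (sym (Fin.toℕ-combine x y)) (sym (Fin.toℕ-combine x z))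
    (ℕ.+-monoʳ-< (c ℕ.* toℕ x) y<z)

  combine-cancel-< : ∀ (x x′ : Fin a) (y y′ : Fin c) → combine x y < combine x′ y′ →
    x < x′ ⊎ x ≡ x′ × y < y′
  combine-cancel-< x x′ y y′ lt with Fin.<-cmp x x′
  ... | tri< x<x′ _ _ = inj₁ x<x′
  ... | tri> _ _ x>x′ = contradiction lt (ℕ.<-asym (Fin.combine-monoˡ-< y′ y x>x′))
  ... | tri≈ _ refl _ with Fin.<-cmp y y′
  ...   | tri< y<y′ _ _ = inj₂ (refl , y<y′)
  ...   | tri≈ _ refl _ = contradiction lt (ℕ.<-irrefl refl)
  ...   | tri> _ _ y>y′ = contradiction lt (ℕ.<-asym (combine-monoʳ-< x y>y′))

  -- The principle of radix sort. When the major letters tie, the pair order falls back on the minor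
  -- letter and then on the position, which is exactly the order of the ranks under τ, and those
  -- ranks are the positions at which `u` is read.
  pairing-precedes : ∀ (u : Fin n → Fin a) (v : Fin n → Fin c) (τ : Permutation′ n) → Standardizes v τ →
    ∀ i j → Precedes (pairing (u ∘ (τ ⟨$⟩ʳ_)) v) i j → Precedes u (τ ⟨$⟩ʳ i) (τ ⟨$⟩ʳ j)
  pairing-precedes u v τ st i j (inj₁ lt) with combine-cancel-< _ _ _ _ lt
  ... | inj₁ ui<uj           = inj₁ ui<uj
  ... | inj₂ (ui≡uj , vi<vj) = inj₂ (ui≡uj , st i j (inj₁ vi<vj))
  pairing-precedes u v τ st i j (inj₂ (eq , i<j)) with Fin.combine-injective _ _ _ _ eq
  ... | ui≡uj , vi≡vj = inj₂ (ui≡uj , st i j (inj₂ (vi≡vj , i<j)))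

  pairing-precedes⁻¹ : ∀ (u : Fin n → Fin a) (v : Fin n → Fin c) (τ : Permutation′ n) →
    Standardizes v τ → ∀ i j → Precedes u (τ ⟨$⟩ʳ i) (τ ⟨$⟩ʳ j) → Precedes (pairing (u ∘ (τ ⟨$⟩ʳ_)) v) i j
  pairing-precedes⁻¹ u v τ st i j (inj₁ ui<uj) = inj₁ (Fin.combine-monoˡ-< (v i) (v j) ui<uj)
  pairing-precedes⁻¹ u v τ st i j (inj₂ (ui≡uj , τi<τj))
    with standardizes⁻¹ v τ st i j τi<τj
  ... | inj₁ vi<vj = inj₁ (subst (λ x → combine (u (τ ⟨$⟩ʳ i)) (v i) < combine x (v j)) ui≡uj
                       (combine-monoʳ-< (u (τ ⟨$⟩ʳ i)) vi<vj))
  ... | inj₂ (vi≡vj , i<j) = inj₂ (cong₂ combine ui≡uj vi≡vj , i<j)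

  standardizes-pairing : ∀ (u : Fin n → Fin a) (v : Fin n → Fin c) (σ τ : Permutation′ n) →
    Standardizes v τ → Standardizes u σ → Standardizes (pairing (u ∘ (τ ⟨$⟩ʳ_)) v) (τ ∘ₚ σ)
  standardizes-pairing u v σ τ stv stu i j i≺j = stu _ _ (pairing-precedes u v τ stv i j i≺j)

  standardizes-pairing⁻¹ : ∀ (u : Fin n → Fin a) (v : Fin n → Fin c) (σ τ : Permutation′ n) →
    Standardizes v τ → Standardizes (pairing (u ∘ (τ ⟨$⟩ʳ_)) v) (τ ∘ₚ σ) → Standardizes u σ
  standardizes-pairing⁻¹ u v σ τ stv st x y x≺y =
    subst₂ (λ x y → σ ⟨$⟩ʳ x < σ ⟨$⟩ʳ y) (Perm.inverseʳ τ) (Perm.inverseʳ τ)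
      (st _ _ (pairing-precedes⁻¹ u v τ stv _ _
        (subst₂ (Precedes u) (sym (Perm.inverseʳ τ)) (sym (Perm.inverseʳ τ)) x≺y)))

open Standardization

-- Compositions as cut points, and descents of the inverse permutation.

module Cuts where

  open import Data.Fin.Base using (_<_; _≤_; fromℕ)

  private variable
    n a : ℕ

  partialSum≤sum : ∀ (b : Vec ℕ a) m → partialSum b m ℕ.≤ Vec.sum b
  partialSum≤sum (x ∷ b) zero    = ℕ.m≤m+n x (Vec.sum b)
  partialSum≤sum (x ∷ b) (suc m) = ℕ.+-monoʳ-≤ x (partialSum≤sum b m)

  partialSum-last : ∀ (b : Vec ℕ (suc a)) → partialSum b (fromℕ a) ≡ Vec.sum b
  partialSum-last (x ∷ [])        = sym (ℕ.+-identityʳ x)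
  partialSum-last (x ∷ b@(_ ∷ _)) = cong (x ℕ.+_) (partialSum-last b)

  partialSum-injective : ∀ (b c : Vec ℕ a) → partialSum b ≗ partialSum c → b ≡ c
  partialSum-injective []      []      eq = refl
  partialSum-injective (x ∷ b) (y ∷ c) eq with eq zero
  ... | refl = cong (x ∷_) (partialSum-injective b c λ m → ℕ.+-cancelˡ-≡ x _ _ (eq (suc m)))

  fromPartialSums : (Fin a → ℕ) → Vec ℕ a
  fromPartialSums {zero}  t = []
  fromPartialSums {suc a} t = t zero ∷ fromPartialSums λ m → t (suc m) ℕ.∸ t zero

  -- Monotonicity of `t` makes the truncated differences exact.
  partialSum-fromPartialSums : ∀ (t : Fin a → ℕ) → (∀ {l m} → l ≤ m → t l ℕ.≤ t m) →
    partialSum (fromPartialSums t) ≗ t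
  partialSum-fromPartialSums t t-mono zero    = refl
  partialSum-fromPartialSums t t-mono (suc m) = trans
    (cong (t zero ℕ.+_) (partialSum-fromPartialSums (λ m → t (suc m) ℕ.∸ t zero)
      (λ l≤m → ℕ.∸-monoˡ-≤ (t zero) (t-mono (s≤s l≤m))) m))
    (ℕ.m+[n∸m]≡n (t-mono {zero} z≤n))

  -- Along π, the word u reads 0 … 0 1 … 1 ⋯ with b m letters equal to m.

  CutBy : Permutation′ n → (Fin n → Fin a) → Vec ℕ a → Set
  CutBy π u b = ∀ i m → (u i ≤ m → toℕ (π ⟨$⟩ʳ i) ℕ.< partialSum b m) ×
                        (toℕ (π ⟨$⟩ʳ i) ℕ.< partialSum b m → u i ≤ m)

  cutBy? : ∀ π (u : Fin n → Fin a) b → Dec (CutBy π u b)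
  cutBy? π u b = Fin.all? λ i → Fin.all? λ m →
    ((u i Fin.≤? m) →-dec (toℕ (π ⟨$⟩ʳ i) ℕ.<? partialSum b m)) ×-dec
    ((toℕ (π ⟨$⟩ʳ i) ℕ.<? partialSum b m) →-dec (u i Fin.≤? m))

  cutBy-resp-≗ : ∀ π {u v : Fin n → Fin a} b → u ≗ v → CutBy π u b → CutBy π v b
  cutBy-resp-≗ π b u≗v cut i m =
    (λ vi≤m → proj₁ (cut i m) (subst (_≤ m) (sym (u≗v i)) vi≤m)) ,
    (λ πi<  → subst (_≤ m) (u≗v i) (proj₂ (cut i m) πi<))

  cutBy-word-unique : ∀ π (u v : Fin n → Fin a) b → CutBy π u b → CutBy π v b → u ≗ v
  cutBy-word-unique π u v b cutᵤ cutᵥ i = Fin.≤-antisym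
    (proj₂ (cutᵤ i _) (proj₁ (cutᵥ i _) (Fin.≤-reflexive refl)))
    (proj₂ (cutᵥ i _) (proj₁ (cutᵤ i _) (Fin.≤-reflexive refl)))

  private
    -- If the cut of `c` lay strictly below that of `b`, the position of rank `partialSum c m` would
    -- have a letter at most `m` according to `b`, and hence a rank below `partialSum c m` according
    -- to `c`.
    partialSum-≤ : ∀ π (u : Fin n → Fin a) b c → Vec.sum b ≡ n →
      CutBy π u b → CutBy π u c → ∀ m → partialSum b m ℕ.≤ partialSum c m
    partialSum-≤ {n} π u b c refl cut-b cut-c m = ℕ.≮⇒≥ λ c<b →
      let i<n = ℕ.<-≤-trans c<b (partialSum≤sum b m)
          i   = fromℕ< i<n
          i≡  : toℕ (π ⟨$⟩ʳ (π ⟨$⟩ˡ i)) ≡ partialSum c m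
          i≡  = trans (cong toℕ (Perm.inverseʳ π)) (Fin.toℕ-fromℕ< i<n)
      in ℕ.<-irrefl i≡ (proj₁ (cut-c _ m) (proj₂ (cut-b _ m)
           (subst (ℕ._< partialSum b m) (sym i≡) c<b)))

  cutBy-composition-unique : ∀ π (u : Fin n → Fin a) b c → Vec.sum b ≡ n → Vec.sum c ≡ n →
    CutBy π u b → CutBy π u c → b ≡ c
  cutBy-composition-unique π u b c Σb≡n Σc≡n cut-b cut-c = partialSum-injective b c λ m →
    ℕ.≤-antisym (partialSum-≤ π u b c Σb≡n cut-b cut-c m)
                (partialSum-≤ π u c b Σc≡n cut-c cut-b m)

  blocks : ∀ (b : Vec ℕ a) → Fin (Vec.sum b) → Fin a
  blocks (zero  ∷ b) i       = suc (blocks b i)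
  blocks (suc x ∷ b) zero    = zero
  blocks (suc x ∷ b) (suc i) = blocks (x ∷ b) i

  private
    partialSum-suc : ∀ x (b : Vec ℕ a) m → partialSum (suc x ∷ b) m ≡ suc (partialSum (x ∷ b) m)
    partialSum-suc x b zero    = refl
    partialSum-suc x b (suc m) = refl

  blocks-cut : ∀ (b : Vec ℕ a) i m → (blocks b i ≤ m → toℕ i ℕ.< partialSum b m) ×
                                      (toℕ i ℕ.< partialSum b m → blocks b i ≤ m)
  blocks-cut (zero  ∷ b) i zero    = (λ ()) , λ ()
  blocks-cut (zero  ∷ b) i (suc m) with blocks-cut b i m
  ... | to , from = (λ le → to (s≤s⁻¹ le)) , λ lt → s≤s (from lt)
  blocks-cut (suc x ∷ b) zero    m =
    (λ _ → subst (0 ℕ.<_) (sym (partialSum-suc x b m)) (s≤s z≤n)) , λ _ → z≤n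
  blocks-cut (suc x ∷ b) (suc i) m with blocks-cut (x ∷ b) i m
  ... | to , from =
    (λ le → subst (suc (toℕ i) ℕ.<_) (sym (partialSum-suc x b m)) (s≤s (to le))) ,
    λ lt → from (s≤s⁻¹ (subst (suc (toℕ i) ℕ.<_) (partialSum-suc x b m) lt))

  -- The m-th partial sum has to be the threshold of the ranks whose letter is at most `m`. These
  -- thresholds grow with `m`, and the last one is `n` because every letter is at most the greatest
  -- one.
  standardizes⇒cutBy : ∀ (u : Fin n → Fin a) π → Standardizes u π →
    ∃ λ b → Vec.sum b ≡ n × CutBy π u b
  standardizes⇒cutBy {zero}  {zero}  u π st = [] , refl , λ ()
  standardizes⇒cutBy {suc n} {zero}  u π st with () ← u zero
  standardizes⇒cutBy {n}     {suc a} u π st = b , Σb≡n , cut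
    where
    segment : ∀ m → ∃ λ t → t ℕ.≤ n × (∀ l → u (π ⟨$⟩ˡ l) ≤ m → toℕ l ℕ.< t) ×
                                       (∀ l → toℕ l ℕ.< t → u (π ⟨$⟩ˡ l) ≤ m)
    segment m = initialSegment (λ l → u (π ⟨$⟩ˡ l) Fin.≤? m)
      λ k≤l → Fin.≤-trans (standardizes⇒monotone u π st k≤l)
    t : Fin (suc a) → ℕ
    t m = proj₁ (segment m)
    t≤n : ∀ m → t m ℕ.≤ n
    t≤n m = proj₁ (proj₂ (segment m))
    t-mono : ∀ {l m} → l ≤ m → t l ℕ.≤ t m
    t-mono {l} {m} l≤m = ℕ.≮⇒≥ λ tm<tl →
      let tm<n = ℕ.<-≤-trans tm<tl (t≤n l)
          i≡   = Fin.toℕ-fromℕ< tm<n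
          u≤m  = ℕ.≤-trans (proj₂ (proj₂ (proj₂ (segment l))) (fromℕ< tm<n)
                   (subst (ℕ._< t l) (sym i≡) tm<tl)) l≤m
      in ℕ.<-irrefl i≡ (proj₁ (proj₂ (proj₂ (segment m))) (fromℕ< tm<n) u≤m)
    b : Vec ℕ (suc a)
    b = fromPartialSums t
    b-sums : partialSum b ≗ t
    b-sums = partialSum-fromPartialSums t t-mono
    cut : CutBy π u b
    cut i m =
      (λ ui≤m → subst (_ ℕ.<_) (sym (b-sums m))
        (proj₁ (proj₂ (proj₂ (segment m))) _
          (subst (λ j → u j ≤ m) (sym (Perm.inverseˡ π)) ui≤m))) ,
      λ πi< → subst (λ j → u j ≤ m) (Perm.inverseˡ π)
        (proj₂ (proj₂ (proj₂ (segment m))) _ (subst (_ ℕ.<_) (b-sums m) πi<))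
    Σb≡n : Vec.sum b ≡ n
    Σb≡n = trans (sym (partialSum-last b)) (trans (b-sums (fromℕ a))
      (ℕ.≤-antisym (t≤n (fromℕ a)) (ℕ.≮⇒≥ λ t<n →
        ℕ.<-irrefl (Fin.toℕ-fromℕ< t<n)
          (proj₁ (proj₂ (proj₂ (segment (fromℕ a)))) (fromℕ< t<n) (Fin.≤fromℕ _)))))

  -- If there is no descent at `l`, the value at the next position is at least as large, so the drop
  -- persists over a shorter interval. When `r` is the next position, the drop is itself a descent.
  -- The induction is on `d`, the number of positions strictly between.
  descent-between : ∀ (π : Permutation′ n) {l r} → l < r → π ⟨$⟩ʳ r < π ⟨$⟩ʳ l →
    ∃ λ i → Descent π i × l ≤ i × i < r
  descent-between {n} π {l} {r} l<r = go (toℕ r ℕ.∸ suc (toℕ l)) l l<r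
      (sym (ℕ.m+[n∸m]≡n l<r))
    where
    go : ∀ d l → l < r → toℕ r ≡ suc (toℕ l) ℕ.+ d → π ⟨$⟩ʳ r < π ⟨$⟩ʳ l →
      ∃ λ i → Descent π i × l ≤ i × i < r
    go d l l<r r≡ πr<πl with ℕ.<-≤-trans (s≤s l<r) (Fin.toℕ<n r)
    ... | l+1<n with fromℕ< l+1<n | Fin.toℕ-fromℕ< l+1<n
    ... | l′ | l′≡l+1 with (π ⟨$⟩ʳ l′) Fin.<? (π ⟨$⟩ʳ l)
    ... | yes πl′<πl = l , inj₂ (l′ , l′≡l+1 , πl′<πl) , ℕ.≤-refl , l<r
    go zero l l<r r≡ πr<πl | _ | l′ | l′≡l+1 | no πl′≮πl =
      contradiction (subst (λ i → π ⟨$⟩ʳ i < π ⟨$⟩ʳ l)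
        (Fin.toℕ-injective (trans r≡ (trans (ℕ.+-identityʳ _) (sym l′≡l+1)))) πr<πl) πl′≮πl
    go (suc d) l l<r r≡ πr<πl | _ | l′ | l′≡l+1 | no πl′≮πl
      with go d l′ (subst (ℕ._< toℕ r) (sym l′≡l+1)
               (subst (suc (toℕ l) ℕ.<_) (sym r≡′) (s≤s (ℕ.m≤m+n _ d))))
             (trans r≡′ (cong (λ x → suc x ℕ.+ d) (sym l′≡l+1)))
             (ℕ.<-≤-trans πr<πl (ℕ.≮⇒≥ πl′≮πl))
      where
      r≡′ : toℕ r ≡ suc (suc (toℕ l)) ℕ.+ d
      r≡′ = trans r≡ (ℕ.+-suc (suc (toℕ l)) d)
    ... | i , desc , l′≤i , i<r =
      i , desc , ℕ.≤-trans (ℕ.n≤1+n _) (subst (ℕ._≤ toℕ i) l′≡l+1 l′≤i) , i<r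

  -- At a genuine descent of the inverse, the positions `x` and `y` of consecutive ranks satisfy
  -- `x > y`, so tie-breaking cannot have ranked `x` first. Its letter is therefore strictly
  -- smaller, and the cut after that letter falls between the two ranks.
  standardizes⇒descentsWithin : ∀ (u : Fin n → Fin a) π b → Vec.sum b ≡ n → CutBy π u b →
    Standardizes u π → DescentsWithin b (flip π)
  standardizes⇒descentsWithin {n} {zero}  u π b Σb≡n cut st i _ with () ← u i
  -- The conventional descent at position `n` is met by the last partial sum.
  standardizes⇒descentsWithin {n} {suc a} u π b Σb≡n cut st i (inj₁ i+1≡n) =
    fromℕ a , trans i+1≡n (sym (trans (partialSum-last b) Σb≡n))
  standardizes⇒descentsWithin {n} {suc a} u π b Σb≡n cut st i (inj₂ (j , j≡i+1 , x>y)) =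
    u x , ℕ.≤-antisym
      (subst (λ k → toℕ k ℕ.< partialSum b (u x)) (Perm.inverseʳ π) (proj₁ (cut x (u x)) ℕ.≤-refl))
      (subst (partialSum b (u x) ℕ.≤_) j≡i+1 (ℕ.≮⇒≥ λ j< →
        ℕ.<⇒≱ ux<uy (proj₂ (cut y (u x))
          (subst (λ k → toℕ k ℕ.< partialSum b (u x)) (sym (Perm.inverseʳ π)) j<))))
    where
    x y : Fin n
    x = π ⟨$⟩ˡ i
    y = π ⟨$⟩ˡ j
    ux<uy : u x < u y
    ux<uy with standardizes⁻¹ u π st x y
      (subst₂ _<_ (sym (Perm.inverseʳ π)) (sym (Perm.inverseʳ π)) (ℕ.≤-reflexive (sym j≡i+1)))
    ... | inj₁ lt        = lt
    ... | inj₂ (_ , x<y) = contradiction x<y (ℕ.<-asym x>y)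

  -- Suppose `x` precedes `y` but receives the larger rank. The cuts force a tie of letters with
  -- `x < y`, so the inverse drops between the two ranks and has a descent there. By assumption that
  -- descent is a cut, but ranks on both sides of a cut carry different letters.
  descentsWithin⇒standardizes : ∀ (u : Fin n → Fin a) π b → CutBy π u b →
    DescentsWithin b (flip π) → Standardizes u π
  descentsWithin⇒standardizes u π b cut within x y x≺y with Fin.<-cmp (π ⟨$⟩ʳ x) (π ⟨$⟩ʳ y)
  ... | tri< πx<πy _ _ = πx<πy
  ... | tri≈ _ πx≡πy _ = contradiction x≺x irreflexive
    where
    x≺x : Precedes u x x
    x≺x = subst (Precedes u x)
      (trans (sym (Perm.inverseˡ π)) (trans (cong (π ⟨$⟩ˡ_) (sym πx≡πy)) (Perm.inverseˡ π))) x≺y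
    irreflexive : ¬ Precedes u x x
    irreflexive (inj₁ lt)       = ℕ.<-irrefl refl lt
    irreflexive (inj₂ (_ , lt)) = ℕ.<-irrefl refl lt
  ... | tri> _ _ πy<πx = contradiction (tied x≺y) λ (ux≡uy , x<y) → clash ux≡uy x<y
    where
    uy≤ux : u y ≤ u x
    uy≤ux = proj₂ (cut y (u x)) (ℕ.<-trans πy<πx (proj₁ (cut x (u x)) ℕ.≤-refl))
    tied : Precedes u x y → u x ≡ u y × x < y
    tied (inj₁ ux<uy) = contradiction uy≤ux (ℕ.<⇒≱ ux<uy)
    tied (inj₂ tie)   = tie
    clash : u x ≡ u y → ¬ x < y
    clash ux≡uy x<y with descent-between (flip π) πy<πx
      (subst₂ _<_ (sym (Perm.inverseˡ π)) (sym (Perm.inverseˡ π)) x<y)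
    ... | i , desc , πy≤i , i<πx with within i desc
    ...   | m , i+1≡ = ℕ.<⇒≱ (proj₁ (cut x m) ux≤m) (subst (ℕ._≤ _) i+1≡ i<πx)
      where
      ux≤m : u x ≤ m
      ux≤m = subst (_≤ m) (sym ux≡uy)
        (proj₂ (cut y m) (subst (toℕ (π ⟨$⟩ʳ y) ℕ.<_) i+1≡ (s≤s πy≤i)))

open Cuts

module RationalPowers where

  open import Algebra.Definitions.RawSemiring ℚ.+-*-rawSemiring public
    using (_^_)
  open CommutativeMonoidSum ℚ.*-1-commutativeMonoid public
    using () renaming (sum to product; sum-cong-≗ to product-cong; sum-permute to product-permute;
      sum-replicate-zero to product-1)

-- The law of the standardization of a weighted random word: compositions, convolution, powers.

module WordLaw where

  open import Data.Fin.Permutation using (_≈_)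
  open import Data.Rational.Base using (_*_)
  open +-*-Solver using (solve; _:=_; _:*_)
  open RationalPowers
  open ≡-Reasoning

  private variable
    n a c : ℕ

  words : ∀ a n → List (Vec (Fin a) n)
  words a zero    = [] ∷ []
  words a (suc n) = cartesianProductWith _∷_ (allFin a) (words a n)

  words-unique : ∀ a n → Unique (words a n)
  words-unique a zero    = [] ∷ []
  words-unique a (suc n) =
    Unique.cartesianProductWith⁺ _∷_ Vec.∷-injective (Unique.allFin⁺ a) (words-unique a n)

  words-complete : ∀ (w : Vec (Fin a) n) → w ∈ words a n
  words-complete []      = here refl
  words-complete (x ∷ w) = ∈-cartesianProductWith⁺ _∷_ (∈-allFin x) (words-complete w)

  lookup-injective : ∀ (v w : Vec (Fin a) n) → lookup v ≗ lookup w → v ≡ w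
  lookup-injective v w eq = trans (sym (Vec.tabulate∘lookup v))
    (trans (Vec.tabulate-cong eq) (Vec.tabulate∘lookup w))

  weight : (Fin a → ℚ) → Vec (Fin a) n → ℚ
  weight q w = product λ i → q (lookup w i)

  rearrange : Permutation′ n → Vec (Fin a) n → Vec (Fin a) n
  rearrange π w = tabulate λ i → lookup w (π ⟨$⟩ʳ i)

  lookup-rearrange : ∀ π (w : Vec (Fin a) n) →
    lookup (rearrange π w) ≗ λ i → lookup w (π ⟨$⟩ʳ i)
  lookup-rearrange π w = Vec.lookup∘tabulate _

  rearrange-flip : ∀ π (w : Vec (Fin a) n) → rearrange π (rearrange (flip π) w) ≡ w
  rearrange-flip π w = lookup-injective _ w λ i → trans (lookup-rearrange π (rearrange (flip π) w) i)
    (trans (lookup-rearrange (flip π) w (π ⟨$⟩ʳ i)) (cong (lookup w) (Perm.inverseˡ π)))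

  rearrange-injective : ∀ π (v w : Vec (Fin a) n) → rearrange π v ≡ rearrange π w → v ≡ w
  rearrange-injective π v w eq = trans (sym (rearrange-flip (flip π) v))
    (trans (cong (rearrange (flip π)) eq) (rearrange-flip (flip π) w))

  weight-rearrange : ∀ q π (w : Vec (Fin a) n) → weight q (rearrange π w) ≡ weight q w
  weight-rearrange q π w = trans (product-cong (λ i → cong q (lookup-rearrange π w i)))
    (sym (product-permute (λ i → q (lookup w i)) π))

  ∑-rearrange : ∀ (π : Permutation′ n) (f : Vec (Fin a) n → ℚ) →
    ∑[ w ∈ words a n ] f w ≡ ∑[ w ∈ words a n ] f (rearrange π w)
  ∑-rearrange {n} {a} π f = ∑-match (λ v w → Vec.≡-dec Fin._≟_ v (rearrange π w))
    (words-unique a n) (words-unique a n)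
    (λ _ _ → cong f)
    (λ { {y = y} {z} _ _ _ refl eq → rearrange-injective π y z eq })
    (λ { _ _ _ refl refl → refl })
    (λ {v} _ _ → rearrange (flip π) v , words-complete _ , sym (rearrange-flip π v))
    (λ {w} _ _ → rearrange π w , words-complete _ , refl)

  law : (Fin a → ℚ) → Permutation′ n → ℚ
  law {a} {n} q π = ∑[ w ∈ words a n ] weight q w * 𝟙 (standardizes? (lookup w) π)

  law-cong : ∀ (q : Fin a → ℚ) {π σ : Permutation′ n} → π ≈ σ → law q π ≡ law q σ
  law-cong {a} {n} q {π} {σ} π≈σ = ∑-cong (words a n) λ w → cong (weight q w *_)
    (𝟙-cong (standardizes? (lookup w) π) (standardizes? (lookup w) σ)
      (standardizes-resp-≈ (lookup w) {π} {σ} π≈σ)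
      (standardizes-resp-≈ (lookup w) {σ} {π} (sym ∘ π≈σ)))

  private
    product-blocks : ∀ (q : Fin a → ℚ) b →
      product (λ i → q (blocks b i)) ≡ product (λ m → q m ^ lookup b m)
    product-blocks q []          = refl
    product-blocks q (zero  ∷ b) = trans (product-blocks (q ∘ suc) b) (sym (ℚ.*-identityˡ _))
    product-blocks q (suc x ∷ b) = trans (cong (q zero *_) (product-blocks q (x ∷ b)))
      (sym (ℚ.*-assoc (q zero) (q zero ^ x) _))

  -- For fixed π, `CutBy` matches the words standardized by π with the compositions allowed by the
  -- descents of its inverse. A composition determines its word: the sorted word `blocks b` read
  -- along π. Words that π does not standardize need no partner, since their terms vanish.
  law-compositions : ∀ (q : Fin a → ℚ) (π : Permutation′ n) →
    ∑[ b ∈ compositions a n ] product (λ m → q m ^ lookup b m) * 𝟙 (descentsWithin? b (flip π))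
    ≡ law q π
  law-compositions {a} {n} q π = sym (∑-match
    (λ w b → cutBy? π (lookup w) b)
    (words-unique a n) (compositions-unique a n)
    (λ {w} {b} _ b∈ cut → term w b (∈-compositions⁻ b∈) cut)
    (λ {w} {b} {c} _ b∈ c∈ → cutBy-composition-unique π (lookup w) b c
      (∈-compositions⁻ b∈) (∈-compositions⁻ c∈))
    (λ {v} {w} {b} _ _ _ cut-v cut-w →
      lookup-injective v w (cutBy-word-unique π (lookup v) (lookup w) b cut-v cut-w))
    (λ {w} _ ≢0 → let b , Σb≡n , cut = standardizes⇒cutBy (lookup w) π
                        (*𝟙≢0 (weight q w) (standardizes? (lookup w) π) ≢0)
                  in b , ∈-compositions⁺ Σb≡n , cut)
    (λ {b} b∈ _ → word b (∈-compositions⁻ b∈) , words-complete _ , word-cut b (∈-compositions⁻ b∈)))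
    where
    word : ∀ b → Vec.sum b ≡ n → Vec (Fin a) n
    word b refl = tabulate λ i → blocks b (π ⟨$⟩ʳ i)
    word-cut : ∀ b (Σb≡n : Vec.sum b ≡ n) → CutBy π (lookup (word b Σb≡n)) b
    word-cut b refl = cutBy-resp-≗ π b (λ i → sym (Vec.lookup∘tabulate _ i))
      λ i m → blocks-cut b (π ⟨$⟩ʳ i) m
    weight-word : ∀ b (Σb≡n : Vec.sum b ≡ n) →
      weight q (word b Σb≡n) ≡ product λ m → q m ^ lookup b m
    weight-word b refl = begin
      weight q (word b refl)
        ≡⟨ product-cong (λ i → cong q (Vec.lookup∘tabulate (λ i → blocks b (π ⟨$⟩ʳ i)) i)) ⟩
      product (λ i → q (blocks b (π ⟨$⟩ʳ i)))
        ≡⟨ sym (product-permute (λ i → q (blocks b i)) π) ⟩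
      product (λ i → q (blocks b i))
        ≡⟨ product-blocks q b ⟩
      product (λ m → q m ^ lookup b m) ∎
    term : ∀ w b → Vec.sum b ≡ n → CutBy π (lookup w) b →
      weight q w * 𝟙 (standardizes? (lookup w) π) ≡
      product (λ m → q m ^ lookup b m) * 𝟙 (descentsWithin? b (flip π))
    term w b Σb≡n cut = cong₂ _*_
      (trans (cong (weight q) (lookup-injective w (word b Σb≡n)
        (cutBy-word-unique π (lookup w) (lookup (word b Σb≡n)) b cut (word-cut b Σb≡n))))
        (weight-word b Σb≡n))
      (𝟙-cong (standardizes? (lookup w) π) (descentsWithin? b (flip π))
        (standardizes⇒descentsWithin (lookup w) π b Σb≡n cut)
        (descentsWithin⇒standardizes (lookup w) π b cut))

  infixr 7 _⊗_
  _⊗_ : (Fin a → ℚ) → (Fin c → ℚ) → Fin (a ℕ.* c) → ℚ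
  _⊗_ {a} {c} q r x = q (proj₁ (remQuot {a} c x)) * r (proj₂ (remQuot {a} c x))

  ⊗-combine : ∀ (q : Fin a → ℚ) (r : Fin c → ℚ) x y → (q ⊗ r) (combine x y) ≡ q x * r y
  ⊗-combine q r x y =
    cong (λ z → q (proj₁ z) * r (proj₂ z)) (Fin.remQuot-combine x y)

  ∑-combine : ∀ a c (f : Fin (a ℕ.* c) → ℚ) →
    ∑ (allFin (a ℕ.* c)) f ≡ ∑[ x ∈ allFin a ] ∑[ y ∈ allFin c ] f (combine x y)
  ∑-combine a c f = trans
    (∑-match (λ z (x , y) → z Fin.≟ combine x y)
      (Unique.allFin⁺ (a ℕ.* c)) (Unique.cartesianProduct⁺ (Unique.allFin⁺ a) (Unique.allFin⁺ c))
      (λ _ _ → cong f)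
      (λ { {y = x , y} {z = x′ , y′} _ _ _ refl eq →
        cong₂ _,_ (Fin.combine-injectiveˡ x y x′ y′ eq) (Fin.combine-injectiveʳ x y x′ y′ eq) })
      (λ { _ _ _ refl refl → refl })
      (λ {z} _ _ → remQuot {a} c z , ∈-cartesianProduct⁺ (∈-allFin _) (∈-allFin _) ,
        sym (Fin.combine-remQuot {a} c z))
      (λ {(x , y)} _ _ → combine x y , ∈-allFin _ , refl))
    (∑-cartesianProductWith _,_ (allFin a) (allFin c) λ (x , y) → f (combine x y))

  zipCombine : Vec (Fin a) n → Vec (Fin c) n → Vec (Fin (a ℕ.* c)) n
  zipCombine = Vec.zipWith combine

  weight-zipCombine : ∀ (q : Fin a → ℚ) (r : Fin c → ℚ) (v : Vec (Fin a) n) w →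
    weight (q ⊗ r) (zipCombine v w) ≡ weight q v * weight r w
  weight-zipCombine q r []      []      = refl
  weight-zipCombine q r (x ∷ v) (y ∷ w) = begin
    (q ⊗ r) (combine x y) * weight (q ⊗ r) (zipCombine v w)
      ≡⟨ cong₂ _*_ (⊗-combine q r x y) (weight-zipCombine q r v w) ⟩
    (q x * r y) * (weight q v * weight r w)
      ≡⟨ solve 4 (λ a b c d → (a :* b) :* (c :* d) := (a :* c) :* (b :* d)) refl
           (q x) (r y) (weight q v) (weight r w) ⟩
    (q x * weight q v) * (r y * weight r w) ∎

  ∑-words-suc : ∀ (f : Vec (Fin a) (suc n) → ℚ) →
    ∑ (words a (suc n)) f ≡ ∑[ x ∈ allFin a ] ∑[ w ∈ words a n ] f (x ∷ w)
  ∑-words-suc {a} {n} f = ∑-cartesianProductWith _∷_ (allFin a) (words a n) f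

  ∑-zipCombine : ∀ (f : Vec (Fin (a ℕ.* c)) n → ℚ) →
    ∑ (words (a ℕ.* c) n) f ≡ ∑[ v ∈ words a n ] ∑[ w ∈ words c n ] f (zipCombine v w)
  ∑-zipCombine {n = zero}  f = sym (ℚ.+-identityʳ _)
  ∑-zipCombine {a} {c} {suc n} f = begin
    ∑ (words (a ℕ.* c) (suc n)) f
      ≡⟨ ∑-words-suc f ⟩
    ∑[ z ∈ allFin (a ℕ.* c) ] ∑[ u ∈ words (a ℕ.* c) n ] f (z ∷ u)
      ≡⟨ ∑-combine a c _ ⟩
    ∑[ x ∈ allFin a ] ∑[ y ∈ allFin c ] ∑[ u ∈ words (a ℕ.* c) n ] f (combine x y ∷ u)
      ≡⟨ ∑-cong (allFin a) (λ x → ∑-cong (allFin c) λ y →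
           ∑-zipCombine {a} {c} {n} λ u → f (combine x y ∷ u)) ⟩
    ∑[ x ∈ allFin a ] ∑[ y ∈ allFin c ] ∑[ v ∈ words a n ] ∑[ w ∈ words c n ]
      f (zipCombine (x ∷ v) (y ∷ w))
      ≡⟨ ∑-cong (allFin a) (λ x → ∑-swap (allFin c) (words a n) λ y v →
           ∑[ w ∈ words c n ] f (zipCombine (x ∷ v) (y ∷ w))) ⟩
    ∑[ x ∈ allFin a ] ∑[ v ∈ words a n ] ∑[ y ∈ allFin c ] ∑[ w ∈ words c n ]
      f (zipCombine (x ∷ v) (y ∷ w))
      ≡⟨ ∑-cong (allFin a) (λ x → ∑-cong (words a n) λ v →
           sym (∑-words-suc λ w → f (zipCombine (x ∷ v) w))) ⟩
    ∑[ x ∈ allFin a ] ∑[ v ∈ words a n ] ∑[ w ∈ words c (suc n) ] f (zipCombine (x ∷ v) w)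
      ≡⟨ sym (∑-words-suc {a} λ v → ∑[ w ∈ words c (suc n) ] f (zipCombine v w)) ⟩
    ∑[ v ∈ words a (suc n) ] ∑[ w ∈ words c (suc n) ] f (zipCombine v w) ∎

  private
    -- Once the minor word `w` with standardization τ is fixed, only one σ contributes, namely `ρ`,
    -- the inverse of τ followed by π. Substituting `rearrange τ v` for `v` preserves the weight and
    -- turns the condition that ρ standardizes `v` into the condition that π standardizes the word
    -- of pairs.
    convolution-word : ∀ (q : Fin a → ℚ) (w : Vec (Fin c) n) (π : Permutation′ n) →
      ∑[ σ ∈ permutations n ] law q σ * 𝟙 (standardizes? (lookup w) (π ∘ₚ flip σ)) ≡
      ∑[ v ∈ words a n ] weight q v * 𝟙 (standardizes? (lookup (zipCombine v w)) π)
    convolution-word {a} {c} {n} q w π with standardization (lookup w)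
    ... | τ , st-w = begin
      ∑[ σ ∈ permutations n ] law q σ * 𝟙 (standardizes? (lookup w) (π ∘ₚ flip σ))
        ≡⟨ ∑-single (permutationSetoid n) {x = ρ} (permutations-unique n) (permutations-complete n ρ)
             (λ {σ} σ≈ρ → trans (cong₂ _*_ (law-cong q {σ} {ρ} σ≈ρ)
               (𝟙-true (standardizes? _ (π ∘ₚ flip σ))
                 (standardizes-resp-≈ (lookup w) {τ} {π ∘ₚ flip σ} (from σ σ≈ρ) st-w)))
               (ℚ.*-identityʳ (law q ρ)))
             (λ {σ} σ≉ρ → trans (cong (law q σ *_) (𝟙-false (standardizes? _ (π ∘ₚ flip σ))
               λ st → σ≉ρ (to σ (standardizes-unique (lookup w) (π ∘ₚ flip σ) τ st st-w))))
               (ℚ.*-zeroʳ (law q σ))) ⟩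
      law q ρ
        ≡⟨⟩
      ∑[ v ∈ words a n ] weight q v * 𝟙 (standardizes? (lookup v) ρ)
        ≡⟨ ∑-cong (words a n) (λ v → cong₂ _*_ (sym (weight-rearrange q τ v))
             (𝟙-cong (standardizes? (lookup v) ρ) (standardizes? _ π)
               (λ st → standardizes-resp-≗ π (sym ∘ paired v)
                 (standardizes-resp-≈ (pairing (λ i → lookup v (τ ⟨$⟩ʳ i)) (lookup w)) {τ ∘ₚ ρ} {π}
                   τρ≈π
                   (standardizes-pairing (lookup v) (lookup w) ρ τ st-w st)))
               (λ st → standardizes-pairing⁻¹ (lookup v) (lookup w) ρ τ st-w
                 (standardizes-resp-≈ (pairing (λ i → lookup v (τ ⟨$⟩ʳ i)) (lookup w)) {π} {τ ∘ₚ ρ}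
                   (sym ∘ τρ≈π)
                   (standardizes-resp-≗ π (paired v) st))))) ⟩
      ∑[ v ∈ words a n ] weight q (rearrange τ v) *
        𝟙 (standardizes? (lookup (zipCombine (rearrange τ v) w)) π)
        ≡⟨ sym (∑-rearrange τ λ v → weight q v * 𝟙 (standardizes? (lookup (zipCombine v w)) π)) ⟩
      ∑[ v ∈ words a n ] weight q v * 𝟙 (standardizes? (lookup (zipCombine v w)) π) ∎
      where
      ρ : Permutation′ n
      ρ = flip τ ∘ₚ π
      τρ≈π : τ ∘ₚ ρ ≈ π
      τρ≈π i = cong (π ⟨$⟩ʳ_) (Perm.inverseˡ τ)
      from : ∀ σ → σ ≈ ρ → τ ≈ π ∘ₚ flip σ
      from σ σ≈ρ i = trans (sym (Perm.inverseˡ σ))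
        (cong (σ ⟨$⟩ˡ_) (trans (σ≈ρ (τ ⟨$⟩ʳ i)) (τρ≈π i)))
      to : ∀ σ → π ∘ₚ flip σ ≈ τ → σ ≈ ρ
      to σ eq i = trans (cong (σ ⟨$⟩ʳ_) (trans (sym (Perm.inverseʳ τ)) (sym (eq (τ ⟨$⟩ˡ i)))))
        (Perm.inverseʳ σ)
      paired : ∀ v → lookup (zipCombine (rearrange τ v) w) ≗
        pairing (λ i → lookup v (τ ⟨$⟩ʳ i)) (lookup w)
      paired v i = trans (Vec.lookup-zipWith combine i (rearrange τ v) w)
        (cong (λ x → combine x (lookup w i)) (lookup-rearrange τ v i))

  -- In the product, the second factor acts first and supplies the minor letter; σ acts last and
  -- supplies the major letter. This is why `q` is the left factor of `q ⊗ r`.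
  law-convolution : ∀ (q : Fin a → ℚ) (r : Fin c → ℚ) (π : Permutation′ n) →
    ∑[ σ ∈ permutations n ] law q σ * law r (π ∘ₚ flip σ) ≡ law (q ⊗ r) π
  law-convolution {a} {c} {n} q r π = begin
    ∑[ σ ∈ permutations n ] law q σ * law r (π ∘ₚ flip σ)
      ≡⟨ ∑-cong (permutations n) (λ σ → sym (∑-*ˡ (words c n) (law q σ) _)) ⟩
    ∑[ σ ∈ permutations n ] ∑[ w ∈ words c n ]
      law q σ * (weight r w * 𝟙 (standardizes? (lookup w) (π ∘ₚ flip σ)))
      ≡⟨ ∑-swap (permutations n) (words c n) _ ⟩
    ∑[ w ∈ words c n ] ∑[ σ ∈ permutations n ]
      law q σ * (weight r w * 𝟙 (standardizes? (lookup w) (π ∘ₚ flip σ)))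
      ≡⟨ ∑-cong (words c n) (λ w → trans
           (∑-cong (permutations n) λ σ → swap-factors (law q σ) (weight r w) _)
           (trans (∑-*ˡ (permutations n) (weight r w) _)
             (cong (weight r w *_) (convolution-word q w π)))) ⟩
    ∑[ w ∈ words c n ] weight r w *
      (∑[ v ∈ words a n ] weight q v * 𝟙 (standardizes? (lookup (zipCombine v w)) π))
      ≡⟨ ∑-cong (words c n) (λ w → sym (∑-*ˡ (words a n) (weight r w) _)) ⟩
    ∑[ w ∈ words c n ] ∑[ v ∈ words a n ]
      weight r w * (weight q v * 𝟙 (standardizes? (lookup (zipCombine v w)) π))
      ≡⟨ ∑-swap (words c n) (words a n) _ ⟩
    ∑[ v ∈ words a n ] ∑[ w ∈ words c n ]
      weight r w * (weight q v * 𝟙 (standardizes? (lookup (zipCombine v w)) π))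
      ≡⟨ ∑-cong (words a n) (λ v → ∑-cong (words c n) λ w → trans
           (collect (weight r w) (weight q v) _)
           (cong (_* _) (sym (weight-zipCombine q r v w)))) ⟩
    ∑[ v ∈ words a n ] ∑[ w ∈ words c n ]
      weight (q ⊗ r) (zipCombine v w) * 𝟙 (standardizes? (lookup (zipCombine v w)) π)
      ≡⟨ sym (∑-zipCombine λ u → weight (q ⊗ r) u * 𝟙 (standardizes? (lookup u) π)) ⟩
    law (q ⊗ r) π ∎
    where
    swap-factors : ∀ x y z → x * (y * z) ≡ y * (x * z)
    swap-factors = solve 3 (λ x y z → x :* (y :* z) := y :* (x :* z)) refl
    collect : ∀ x y z → x * (y * z) ≡ (y * x) * z
    collect = solve 3 (λ x y z → x :* (y :* z) := (y :* x) :* z) refl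

  infixr 8 _⊗^_
  _⊗^_ : (Fin a → ℚ) → ∀ k → Fin (a ℕ.^ k) → ℚ
  q ⊗^ zero  = λ _ → 1ℚ
  q ⊗^ suc k = q ⊗ (q ⊗^ k)

  -- The zeroth power: the alphabet of empty tuples has one letter, and a constant word is already
  -- sorted. The decision procedure is a parameter so that the one built into `pointMass` can be
  -- supplied.
  law-one-letter : ∀ (id≈? : (π : Permutation′ n) → Dec (Perm.id ≈ π)) (π : Permutation′ n) →
    law {1} (λ _ → 1ℚ) π ≡ 𝟙 (id≈? π)
  law-one-letter {n} id≈? π = ∑-single (setoid (Vec (Fin 1) n)) (words-unique 1 n)
    (words-complete (Vec.replicate n zero))
    (λ {w} _ → trans (cong₂ _*_ (product-1 n) (𝟙-cong (standardizes? (lookup w) π) (id≈? π)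
        (λ st → standardizes-unique (lookup w) Perm.id π (constant w) st)
        (λ id≈π → standardizes-resp-≈ (lookup w) {Perm.id} {π} id≈π (constant w))))
      (ℚ.*-identityˡ (𝟙 (id≈? π))))
    (λ {w} w≢ → contradiction (lookup-injective w _ λ i → one-letter _ _) w≢)
    where
    one-letter : ∀ (x y : Fin 1) → x ≡ y
    one-letter zero zero = refl
    constant : ∀ w → Standardizes (lookup w) Perm.id
    constant w = standardizes-constant (lookup w) λ i j → one-letter _ _

open WordLaw

-- Union bounds for the weight of words with a repeated letter.

module Collisions where

  open import Data.Rational.Base using (_+_; _*_; ∣_∣; _≤_)
  open +-*-Solver using (solve; _:=_; _:+_; _:*_; con)
  open RationalPowers

  private variable
    n : ℕ

  ι : ℕ → ℚ
  ι n = ℤ.+ n ℚ./ 1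

  -- The comparison is made in the unnormalised rationals, because the normalization inside `ι` does
  -- not compute for a variable argument.
  ι-+ : ∀ m n → ι (m ℕ.+ n) ≡ ι m + ι n
  ι-+ m n = ℚ.toℚᵘ-injective (begin-equality
    ℚ.toℚᵘ (ι (m ℕ.+ n))             ≃⟨ ℚ.toℚᵘ-fromℚᵘ (ℚᵘ.mkℚᵘ (ℤ.+ (m ℕ.+ n)) 0) ⟩
    ℚᵘ.mkℚᵘ (ℤ.+ (m ℕ.+ n)) 0          ≃⟨ ℚᵘ.*≡* (cong (ℤ._* ℤ.+ 1)
      (sym (cong₂ ℤ._+_ (ℤ.*-identityʳ (ℤ.+ m)) (ℤ.*-identityʳ (ℤ.+ n))))) ⟩
    ℚᵘ.mkℚᵘ (ℤ.+ m) 0 ℚᵘ.+ ℚᵘ.mkℚᵘ (ℤ.+ n) 0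
      ≃⟨ ℚᵘ.+-cong (ℚ.toℚᵘ-fromℚᵘ (ℚᵘ.mkℚᵘ (ℤ.+ m) 0)) (ℚ.toℚᵘ-fromℚᵘ (ℚᵘ.mkℚᵘ (ℤ.+ n) 0)) ⟨
    ℚ.toℚᵘ (ι m) ℚᵘ.+ ℚ.toℚᵘ (ι n)   ≃⟨ ℚ.toℚᵘ-homo-+ (ι m) (ι n) ⟨
    ℚ.toℚᵘ (ι m + ι n)               ∎)
    where open ℚᵘ.≤-Reasoning

  ι*1/ : ∀ n .{{_ : ℕ.NonZero n}} → ι n * (ℤ.+ 1 ℚ./ n) ≡ 1ℚ
  ι*1/ n@(suc k) = ℚ.toℚᵘ-injective (begin-equality
    ℚ.toℚᵘ (ι n * (ℤ.+ 1 ℚ./ n))             ≃⟨ ℚ.toℚᵘ-homo-* (ι n) (ℤ.+ 1 ℚ./ n) ⟩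
    ℚ.toℚᵘ (ι n) ℚᵘ.* ℚ.toℚᵘ (ℤ.+ 1 ℚ./ n)
      ≃⟨ ℚᵘ.*-cong (ℚ.toℚᵘ-fromℚᵘ (ℚᵘ.mkℚᵘ (ℤ.+ n) 0)) (ℚ.toℚᵘ-fromℚᵘ (ℚᵘ.mkℚᵘ (ℤ.+ 1) k)) ⟩
    ℚᵘ.mkℚᵘ (ℤ.+ n) 0 ℚᵘ.* ℚᵘ.mkℚᵘ (ℤ.+ 1) k   ≃⟨ ℚᵘ.*≡* (trans (ℤ.*-identityʳ _)
      (trans (ℤ.*-identityʳ (ℤ.+ n))
        (sym (trans (ℤ.*-identityˡ _) (cong ℤ.+_ (ℕ.+-identityʳ n)))))) ⟩
    ℚᵘ.1ℚᵘ                                 ∎)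
    where open ℚᵘ.≤-Reasoning

  0≤ι : ∀ n → 0ℚ ≤ ι n
  0≤ι n = ℚ.nonNegative⁻¹ (ι n) {{ℚ.normalize-nonNeg n 1}}

  ∑-permutations-const : ∀ n c → ∑ (permutations n) (λ _ → c) ≡ ι (n !) * c
  ∑-permutations-const zero    c = trans (ℚ.+-identityʳ c) (sym (ℚ.*-identityˡ c))
  ∑-permutations-const (suc n) c = begin
    ∑ (permutations (suc n)) (λ _ → c)
      ≡⟨ ∑-cartesianProductWith (Perm.insert zero) (allFin (suc n)) (permutations n) (λ _ → c) ⟩
    ∑[ j ∈ allFin (suc n) ] ∑[ σ ∈ permutations n ] c
      ≡⟨ ∑-cong (allFin (suc n)) (λ j → ∑-permutations-const n c) ⟩
    ∑[ j ∈ allFin (suc n) ] ι (n !) * c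
      ≡⟨ ∑-*ʳ (allFin (suc n)) c (λ _ → ι (n !)) ⟩
    (∑[ j ∈ allFin (suc n) ] ι (n !)) * c
      ≡⟨ cong (_* c) (∑-tabulate (suc n) id) ⟩
    ι (suc n !) * c ∎
    where
    open ≡-Reasoning
    ∑-tabulate : ∀ {A : Set} m (f : Fin m → A) → ∑ (List.tabulate f) (λ _ → ι (n !)) ≡ ι (m ℕ.* n !)
    ∑-tabulate zero    f = refl
    ∑-tabulate (suc m) f = trans (cong (ι (n !) +_) (∑-tabulate m (f ∘ suc)))
      (sym (ι-+ (n !) (m ℕ.* n !)))

  module _ {a : ℕ} where

    total : (Fin a → ℚ) → ℚ
    total q = ∑ (allFin a) q

    ∑-weight : ∀ q n → ∑[ w ∈ words a n ] weight q w ≡ total q ^ n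
    ∑-weight q zero    = ℚ.+-identityʳ 1ℚ
    ∑-weight q (suc n) = begin
      ∑[ w ∈ words a (suc n) ] weight q w                     ≡⟨ ∑-words-suc (weight q) ⟩
      ∑[ x ∈ allFin a ] ∑[ w ∈ words a n ] q x * weight q w
        ≡⟨ ∑-product (allFin a) (words a n) q (weight q) ⟩
      total q * ∑ (words a n) (weight q)                      ≡⟨ cong (total q *_) (∑-weight q n) ⟩
      total q * total q ^ n                                   ∎
      where open ≡-Reasoning

    ∣weight∣ : ∀ q (w : Vec (Fin a) n) → ∣ weight q w ∣ ≡ weight (∣_∣ ∘ q) w
    ∣weight∣ q []      = refl
    ∣weight∣ q (x ∷ w) = trans (ℚ.∣p*q∣≡∣p∣*∣q∣ (q x) (weight q w)) (cong (∣ q x ∣ *_) (∣weight∣ q w))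

    weight-nonNeg : ∀ {r} → (∀ x → 0ℚ ≤ r x) → ∀ (w : Vec (Fin a) n) → 0ℚ ≤ weight r w
    weight-nonNeg 0≤r []      = ℚ.nonNegative⁻¹ 1ℚ
    weight-nonNeg 0≤r (x ∷ w) = 0≤* (0≤r x) (weight-nonNeg 0≤r w)

    Occurs : Fin a → (Fin n → Fin a) → Set
    Occurs x u = ∃ λ i → x ≡ u i

    occurs? : ∀ x (u : Fin n → Fin a) → Dec (Occurs x u)
    occurs? x u = Fin.any? λ i → x Fin.≟ u i

    private
      𝟙-union : ∀ {P Q R : Set} (P? : Dec P) (Q? : Dec Q) (R? : Dec R) →
        (P → Q ⊎ R) → 𝟙 P? ≤ 𝟙 Q? + 𝟙 R?
      𝟙-union (no _)  Q? R? f = ℚ.+-mono-≤ (0≤𝟙 Q?) (0≤𝟙 R?)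
      𝟙-union (yes p) Q? R? f with f p
      ... | inj₁ q = subst (_≤ 𝟙 Q? + 𝟙 R?) (trans (ℚ.+-identityʳ _) (𝟙-true Q? q))
        (ℚ.+-monoʳ-≤ (𝟙 Q?) (0≤𝟙 R?))
      ... | inj₂ r = subst (_≤ 𝟙 Q? + 𝟙 R?) (trans (ℚ.+-identityˡ _) (𝟙-true R? r))
        (ℚ.+-monoˡ-≤ (𝟙 R?) (0≤𝟙 Q?))

      occurs-∷ : ∀ {x y} {w : Vec (Fin a) n} →
        Occurs x (lookup (y ∷ w)) → x ≡ y ⊎ Occurs x (lookup w)
      occurs-∷ (zero  , x≡y)  = inj₁ x≡y
      occurs-∷ (suc i , x≡wi) = inj₂ (i , x≡wi)

      collision-∷ : ∀ {x} {w : Vec (Fin a) n} →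
        ¬ Distinct (lookup (x ∷ w)) → Occurs x (lookup w) ⊎ ¬ Distinct (lookup w)
      collision-∷ {x = x} {w} ¬d with occurs? x (lookup w) | distinct? (lookup w)
      ... | yes occ | _      = inj₁ occ
      ... | no _    | no ¬d′ = inj₂ ¬d′
      ... | no ¬occ | yes d  = contradiction distinct ¬d
        where
        distinct : Distinct (lookup (x ∷ w))
        distinct zero    zero    _  = refl
        distinct zero    (suc j) eq = contradiction (j , eq) ¬occ
        distinct (suc i) zero    eq = contradiction (i , sym eq) ¬occ
        distinct (suc i) (suc j) eq = cong suc (d i j eq)

    module Bounds (r : Fin a → ℚ) (0≤r : ∀ x → 0ℚ ≤ r x) where

      open ℚ.≤-Reasoning

      T R : ℚ
      T = total r
      R = ∑[ x ∈ allFin a ] r x * r x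

      0≤T : 0ℚ ≤ T
      0≤T = ∑-nonNeg (allFin a) 0≤r

      -- A union bound over the `n` places where `x` can stand: it costs `r x` there, and the other
      -- letters are free. The truncated exponent matters only for `n` equal to 0, where the factor
      -- `ι n` vanishes.
      ∑-occurs : ∀ n x → ∑[ w ∈ words a n ] weight r w * 𝟙 (occurs? x (lookup w)) ≤
        ι n * (r x * T ^ (n ℕ.∸ 1))
      ∑-occurs zero    x = ℚ.≤-reflexive (trans (ℚ.+-identityʳ _) (trans (ℚ.*-zeroʳ 1ℚ)
        (sym (ℚ.*-zeroˡ (r x * 1ℚ)))))
      ∑-occurs (suc n) x = begin
        ∑[ w ∈ words a (suc n) ] weight r w * 𝟙 (occurs? x (lookup w))
          ≡⟨ ∑-words-suc (λ w → weight r w * 𝟙 (occurs? x (lookup w))) ⟩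
        ∑[ y ∈ allFin a ] ∑[ w ∈ words a n ] weight r (y ∷ w) * 𝟙 (occurs? x (lookup (y ∷ w)))
          ≤⟨ ∑-mono (allFin a) (λ y → ∑-mono (words a n) λ w → step y w) ⟩
        ∑[ y ∈ allFin a ] ∑[ w ∈ words a n ]
          ((r y * 𝟙 (x Fin.≟ y)) * weight r w + r y * (weight r w * 𝟙 (occurs? x (lookup w))))
          ≡⟨ trans (∑-cong (allFin a) (λ y → ∑-+ (words a n) _ _)) (∑-+ (allFin a) _ _) ⟩
        (∑[ y ∈ allFin a ] ∑[ w ∈ words a n ] (r y * 𝟙 (x Fin.≟ y)) * weight r w) +
        (∑[ y ∈ allFin a ] ∑[ w ∈ words a n ] r y * (weight r w * 𝟙 (occurs? x (lookup w))))
          ≡⟨ cong₂ _+_ (∑-product (allFin a) (words a n) _ _) (∑-product (allFin a) (words a n) _ _) ⟩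
        (∑[ y ∈ allFin a ] r y * 𝟙 (x Fin.≟ y)) * ∑ (words a n) (weight r) +
        T * (∑[ w ∈ words a n ] weight r w * 𝟙 (occurs? x (lookup w)))
          ≤⟨ ℚ.+-mono-≤ (ℚ.≤-reflexive (cong₂ _*_ letter (∑-weight r n)))
               (*-monoˡ-≤ T 0≤T (∑-occurs n x)) ⟩
        r x * T ^ n + T * (ι n * (r x * T ^ (n ℕ.∸ 1)))
          ≡⟨ cong (r x * T ^ n +_) (shift n) ⟩
        r x * T ^ n + ι n * (r x * T ^ n)
          ≡⟨ collect (ι n) (r x * T ^ n) ⟩
        (1ℚ + ι n) * (r x * T ^ n)
          ≡⟨ cong (_* (r x * T ^ n)) (sym (ι-+ 1 n)) ⟩
        ι (suc n) * (r x * T ^ n) ∎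
        where
        collect : ∀ m y → y + m * y ≡ (1ℚ + m) * y
        collect = solve 2 (λ m y → y :+ m :* y := (con 1ℚ :+ m) :* y) refl
        shift : ∀ n → T * (ι n * (r x * T ^ (n ℕ.∸ 1))) ≡ ι n * (r x * T ^ n)
        shift zero    = trans (cong (T *_) (ℚ.*-zeroˡ (r x * 1ℚ)))
          (trans (ℚ.*-zeroʳ T) (sym (ℚ.*-zeroˡ (r x * 1ℚ))))
        shift (suc n) = solve 4 (λ t m x p → t :* (m :* (x :* p)) := m :* (x :* (t :* p))) refl
          T (ι (suc n)) (r x) (T ^ n)
        letter : ∑[ y ∈ allFin a ] r y * 𝟙 (x Fin.≟ y) ≡ r x
        letter = ∑-single (setoid (Fin a)) (Unique.allFin⁺ a) (∈-allFin x)
          (λ { refl → trans (cong (r x *_) (𝟙-true (x Fin.≟ x) refl)) (ℚ.*-identityʳ (r x)) })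
          (λ {y} y≢x → trans (cong (r y *_) (𝟙-false (x Fin.≟ y) (y≢x ∘ sym))) (ℚ.*-zeroʳ (r y)))
        step : ∀ y (w : Vec (Fin a) n) → weight r (y ∷ w) * 𝟙 (occurs? x (lookup (y ∷ w))) ≤
          (r y * 𝟙 (x Fin.≟ y)) * weight r w + r y * (weight r w * 𝟙 (occurs? x (lookup w)))
        step y w = begin
          weight r (y ∷ w) * 𝟙 (occurs? x (lookup (y ∷ w)))
            ≤⟨ *-monoˡ-≤ (weight r (y ∷ w)) (weight-nonNeg 0≤r (y ∷ w))
                 (𝟙-union (occurs? x (lookup (y ∷ w))) (x Fin.≟ y)
                   (occurs? x (lookup w)) (occurs-∷ {w = w})) ⟩
          (r y * weight r w) * (𝟙 (x Fin.≟ y) + 𝟙 (occurs? x (lookup w)))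
            ≡⟨ solve 4 (λ y w d e → (y :* w) :* (d :+ e) := (y :* d) :* w :+ y :* (w :* e)) refl
                 (r y) (weight r w) (𝟙 (x Fin.≟ y)) (𝟙 (occurs? x (lookup w))) ⟩
          (r y * 𝟙 (x Fin.≟ y)) * weight r w + r y * (weight r w * 𝟙 (occurs? x (lookup w))) ∎

      -- The exponent is truncated only for n ≤ 1, where n C 2 = 0.
      ∑-collisions : ∀ n → ∑[ w ∈ words a n ] weight r w * 𝟙 (¬? (distinct? (lookup w))) ≤
        ι (n C 2) * (R * T ^ (n ℕ.∸ 2))
      ∑-collisions zero    = ℚ.≤-reflexive (trans (ℚ.+-identityʳ _) (trans (ℚ.*-zeroʳ 1ℚ)
        (sym (ℚ.*-zeroˡ (R * 1ℚ)))))
      ∑-collisions (suc n) = begin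
        ∑[ w ∈ words a (suc n) ] weight r w * 𝟙 (¬? (distinct? (lookup w)))
          ≡⟨ ∑-words-suc (λ w → weight r w * 𝟙 (¬? (distinct? (lookup w)))) ⟩
        ∑[ x ∈ allFin a ] ∑[ w ∈ words a n ] weight r (x ∷ w) * 𝟙 (¬? (distinct? (lookup (x ∷ w))))
          ≤⟨ ∑-mono (allFin a) (λ x → ∑-mono (words a n) λ w → step x w) ⟩
        ∑[ x ∈ allFin a ] ∑[ w ∈ words a n ]
          (r x * (weight r w * 𝟙 (occurs? x (lookup w))) +
           r x * (weight r w * 𝟙 (¬? (distinct? (lookup w)))))
          ≡⟨ trans (∑-cong (allFin a) (λ x → ∑-+ (words a n) _ _)) (∑-+ (allFin a) _ _) ⟩
        (∑[ x ∈ allFin a ] ∑[ w ∈ words a n ] r x * (weight r w * 𝟙 (occurs? x (lookup w)))) +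
        (∑[ x ∈ allFin a ] ∑[ w ∈ words a n ] r x * (weight r w * 𝟙 (¬? (distinct? (lookup w)))))
          ≡⟨ cong₂ _+_ (∑-cong (allFin a) λ x → ∑-*ˡ (words a n) (r x) _)
               (∑-product (allFin a) (words a n) _ _) ⟩
        (∑[ x ∈ allFin a ] r x * (∑[ w ∈ words a n ] weight r w * 𝟙 (occurs? x (lookup w)))) +
        T * (∑[ w ∈ words a n ] weight r w * 𝟙 (¬? (distinct? (lookup w))))
          ≤⟨ ℚ.+-mono-≤ (∑-mono (allFin a) λ x → *-monoˡ-≤ (r x) (0≤r x) (∑-occurs n x))
               (*-monoˡ-≤ T 0≤T (∑-collisions n)) ⟩
        (∑[ x ∈ allFin a ] r x * (ι n * (r x * T ^ (n ℕ.∸ 1)))) +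
        T * (ι (n C 2) * (R * T ^ (n ℕ.∸ 2)))
          ≡⟨ cong₂ _+_ (trans (∑-cong (allFin a) λ x → rotate (r x) (ι n) (T ^ (n ℕ.∸ 1)))
               (trans (∑-*ʳ (allFin a) (ι n * T ^ (n ℕ.∸ 1)) (λ x → r x * r x))
                 (rotate′ R (ι n) (T ^ (n ℕ.∸ 1))))) (shift n) ⟩
        ι n * (R * T ^ (n ℕ.∸ 1)) + ι (n C 2) * (R * T ^ (n ℕ.∸ 1))
          ≡⟨ sym (ℚ.*-distribʳ-+ (R * T ^ (n ℕ.∸ 1)) (ι n) (ι (n C 2))) ⟩
        (ι n + ι (n C 2)) * (R * T ^ (n ℕ.∸ 1))
          -- Pascal's rule: `n` pairs contain the new first letter, and `n C 2` pairs lie in the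
          -- tail.
          ≡⟨ cong (_* (R * T ^ (n ℕ.∸ 1))) (trans (sym (ι-+ n (n C 2))) (cong ι
               (trans (cong (ℕ._+ n C 2) (sym (nC1≡n n))) (nCk+nC[k+1]≡[n+1]C[k+1] n 1)))) ⟩
        ι (suc n C 2) * (R * T ^ (n ℕ.∸ 1)) ∎
        where
        rotate : ∀ x m t → x * (m * (x * t)) ≡ (x * x) * (m * t)
        rotate = solve 3 (λ x m t → x :* (m :* (x :* t)) := (x :* x) :* (m :* t)) refl
        rotate′ : ∀ s m t → s * (m * t) ≡ m * (s * t)
        rotate′ = solve 3 (λ s m t → s :* (m :* t) := m :* (s :* t)) refl
        vanish : ∀ x y → x * (0ℚ * y) ≡ 0ℚ * y
        vanish = solve 2 (λ x y → x :* (con 0ℚ :* y) := con 0ℚ :* y) refl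
        shift : ∀ n → T * (ι (n C 2) * (R * T ^ (n ℕ.∸ 2))) ≡ ι (n C 2) * (R * T ^ (n ℕ.∸ 1))
        shift 0 = vanish T (R * 1ℚ)
        shift 1 = vanish T (R * 1ℚ)
        shift (suc (suc n)) = solve 4 (λ t m x p → t :* (m :* (x :* p)) := m :* (x :* (t :* p))) refl
          T (ι (suc (suc n) C 2)) R (T ^ n)
        step : ∀ x (w : Vec (Fin a) n) →
          weight r (x ∷ w) * 𝟙 (¬? (distinct? (lookup (x ∷ w)))) ≤
          r x * (weight r w * 𝟙 (occurs? x (lookup w))) +
          r x * (weight r w * 𝟙 (¬? (distinct? (lookup w))))
        step x w = begin
          weight r (x ∷ w) * 𝟙 (¬? (distinct? (lookup (x ∷ w))))
            ≤⟨ *-monoˡ-≤ (weight r (x ∷ w)) (weight-nonNeg 0≤r (x ∷ w))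
                 (𝟙-union (¬? (distinct? (lookup (x ∷ w)))) (occurs? x (lookup w))
                   (¬? (distinct? (lookup w))) (collision-∷ {w = w})) ⟩
          (r x * weight r w) * (𝟙 (occurs? x (lookup w)) + 𝟙 (¬? (distinct? (lookup w))))
            ≡⟨ solve 4 (λ x w d e → (x :* w) :* (d :+ e) := x :* (w :* d) :+ x :* (w :* e)) refl
                 (r x) (weight r w) (𝟙 (occurs? x (lookup w))) (𝟙 (¬? (distinct? (lookup w)))) ⟩
          r x * (weight r w * 𝟙 (occurs? x (lookup w))) +
          r x * (weight r w * 𝟙 (¬? (distinct? (lookup w)))) ∎

open Collisions

-- Distance to uniform for rational weights, with explicit corrections.

module Distance where

  open import Data.Rational.Base using (_+_; _*_; _-_; ∣_∣; _≤_)
  open +-*-Solver using (solve; _:=_; _:+_; _:*_; _:-_; :-_; con)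
  open RationalPowers

  private variable
    a : ℕ

  ∣∣-square : ∀ x → ∣ x ∣ * ∣ x ∣ ≡ x * x
  ∣∣-square x with ℚ.∣p∣≡p∨∣p∣≡-p x
  ... | inj₁ eq = cong₂ _*_ eq eq
  ... | inj₂ eq = trans (cong₂ _*_ eq eq) (solve 1 (λ x → (:- x) :* (:- x) := x :* x) refl x)

  module _ {a n : ℕ} (q : Fin a → ℚ) where

    private
      ws : List (Vec (Fin a) n)
      ws = words a n
      πs : List (Permutation′ n)
      πs = permutations n
      u : ℚ
      u = (ℤ.+ 1 ℚ./ (n !)) {{n ℕ.!≢0}}
      distinct : Vec (Fin a) n → ℚ
      distinct w = 𝟙 (distinct? (lookup w))
      collides : Vec (Fin a) n → ℚ
      collides w = 𝟙 (¬? (distinct? (lookup w)))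
      sorts : Vec (Fin a) n → Permutation′ n → ℚ
      sorts w π = 𝟙 (standardizes? (lookup w) π)
      main error : Permutation′ n → ℚ
      main  π = ∑[ w ∈ ws ] weight q w * (distinct w * sorts w π)
      error π = ∑[ w ∈ ws ] weight q w * (collides w * sorts w π)
      r : Fin a → ℚ
      r = ∣_∣ ∘ q
      E D : ℚ
      E = ∑[ w ∈ ws ] weight r w * collides w
      D = ∣ total q ^ n - 1ℚ ∣

      law-split : ∀ π → law q π ≡ main π + error π
      law-split π = trans (∑-cong ws λ w → split (weight q w) (sorts w π) (distinct? (lookup w)))
        (∑-+ ws _ _)
        where
        split : ∀ x s {P : Set} (P? : Dec P) → x * s ≡ x * (𝟙 P? * s) + x * (𝟙 (¬? P?) * s)
        split x s (yes _) =
          solve 2 (λ x s → x :* s := x :* (con 1ℚ :* s) :+ x :* (con 0ℚ :* s)) refl x s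
        split x s (no _)  =
          solve 2 (λ x s → x :* s := x :* (con 0ℚ :* s) :+ x :* (con 1ℚ :* s)) refl x s

      -- Rearranging by π is a weight-preserving bijection of words. It carries the words with
      -- distinct letters that are already sorted to those standardized by π.
      main-constant : ∀ π → main π ≡ main Perm.id
      main-constant π = trans (∑-rearrange π λ w → weight q w * (distinct w * sorts w π))
        (∑-cong ws λ w → cong₂ _*_ (weight-rearrange q π w) (both w))
        where
        𝟙-× : ∀ {P Q : Set} (P? : Dec P) (Q? : Dec Q) → 𝟙 P? * 𝟙 Q? ≡ 𝟙 (P? ×-dec Q?)
        𝟙-× P?@(yes p) Q? = trans (ℚ.*-identityˡ (𝟙 Q?)) (𝟙-cong Q? (P? ×-dec Q?) (p ,_) proj₂)
        𝟙-× (no _)  Q? = ℚ.*-zeroˡ (𝟙 Q?)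
        both : ∀ w → distinct (rearrange π w) * sorts (rearrange π w) π ≡ distinct w * sorts w Perm.id
        both w = trans (𝟙-× (distinct? v) (standardizes? v π)) (trans
          (𝟙-cong (distinct? v ×-dec standardizes? v π)
            (distinct? (lookup w) ×-dec standardizes? (lookup w) Perm.id) to from)
          (sym (𝟙-× (distinct? (lookup w)) (standardizes? (lookup w) Perm.id))))
          where
          v : Fin n → Fin a
          v = lookup (rearrange π w)
          to : Distinct (lookup (rearrange π w)) × Standardizes (lookup (rearrange π w)) π →
            Distinct (lookup w) × Standardizes (lookup w) Perm.id
          to (d , st) = d′ , distinct-standardizes⁻¹ (lookup w) π d′
            (standardizes-resp-≗ π (lookup-rearrange π w) st)
            where
            d′ : Distinct (lookup w)
            d′ i j eq = trans (sym (Perm.inverseʳ π)) (trans (cong (π ⟨$⟩ʳ_) (d _ _ (trans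
              (at i) (trans eq (sym (at j)))))) (Perm.inverseʳ π))
              where
              at : ∀ i → lookup (rearrange π w) (π ⟨$⟩ˡ i) ≡ lookup w i
              at i = trans (lookup-rearrange π w _) (cong (lookup w) (Perm.inverseʳ π))
          from : Distinct (lookup w) × Standardizes (lookup w) Perm.id →
            Distinct (lookup (rearrange π w)) × Standardizes (lookup (rearrange π w)) π
          from (d , st) =
            (λ i j eq → distinct-rearrange (lookup w) π d i j
              (trans (sym (lookup-rearrange π w i)) (trans eq (lookup-rearrange π w j)))) ,
            standardizes-resp-≗ π (sym ∘ lookup-rearrange π w)
              (distinct-standardizes (lookup w) π d st)

      ∑-sorts : ∀ w → ∑[ π ∈ πs ] sorts w π ≡ 1ℚ
      ∑-sorts w = let τ , st = standardization (lookup w) in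
        ∑-single (permutationSetoid n) {x = τ} (permutations-unique n) (permutations-complete n τ)
          (λ {π} π≈τ → 𝟙-true (standardizes? _ π)
            (standardizes-resp-≈ (lookup w) {τ} {π} (sym ∘ π≈τ) st))
          (λ {π} π≉τ → 𝟙-false (standardizes? _ π) λ st′ →
            π≉τ (standardizes-unique (lookup w) π τ st′ st))

      -- Every word has exactly one standardization, so summing over all permutations removes the
      -- condition.
      ∑∑-sorts : ∀ (f : Vec (Fin a) n → ℚ) → ∑[ π ∈ πs ] ∑[ w ∈ ws ] f w * sorts w π ≡ ∑ ws f
      ∑∑-sorts f = trans (∑-swap πs ws _) (∑-cong ws λ w → trans (∑-*ˡ πs (f w) (sorts w))
        (trans (cong (f w *_) (∑-sorts w)) (ℚ.*-identityʳ (f w))))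

      ∑-law : ∑[ π ∈ πs ] law q π ≡ total q ^ n
      ∑-law = trans (∑∑-sorts (weight q)) (∑-weight q n)

      ∑-∣error∣ : ∑[ π ∈ πs ] ∣ error π ∣ ≤ E
      ∑-∣error∣ = begin
        ∑[ π ∈ πs ] ∣ error π ∣
          ≤⟨ ∑-mono πs (λ π → ∣∑∣≤∑∣∣ ws _) ⟩
        ∑[ π ∈ πs ] ∑[ w ∈ ws ] ∣ weight q w * (collides w * sorts w π) ∣
          ≡⟨ ∑-cong πs (λ π → ∑-cong ws λ w → trans
               (ℚ.∣p*q∣≡∣p∣*∣q∣ (weight q w) (collides w * sorts w π)) (trans
               (cong₂ _*_ (∣weight∣ q w) (ℚ.0≤p⇒∣p∣≡p
                 (0≤* (0≤𝟙 (¬? (distinct? (lookup w)))) (0≤𝟙 (standardizes? (lookup w) π)))))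
               (sym (ℚ.*-assoc (weight r w) (collides w) (sorts w π))))) ⟩
        ∑[ π ∈ πs ] ∑[ w ∈ ws ] (weight r w * collides w) * sorts w π
          ≡⟨ ∑∑-sorts (λ w → weight r w * collides w) ⟩
        E ∎
        where open ℚ.≤-Reasoning

      -- Both functions are constant, so the sum of the absolute differences is the absolute
      -- difference of the total masses. That of `main` is the total mass of the law minus that of
      -- the error, and that of the uniform law is 1.
      ∑-∣main-u∣ : ∑[ π ∈ πs ] ∣ main π - u ∣ ≤ D + E
      ∑-∣main-u∣ = begin
        ∑[ π ∈ πs ] ∣ main π - u ∣
          ≡⟨ ∑-cong πs (λ π → cong (λ x → ∣ x - u ∣) (main-constant π)) ⟩
        ∑[ π ∈ πs ] ∣ j - u ∣
          ≡⟨ ∑-permutations-const n ∣ j - u ∣ ⟩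
        ι (n !) * ∣ j - u ∣
          ≡⟨ cong (_* ∣ j - u ∣) (sym (ℚ.0≤p⇒∣p∣≡p (0≤ι (n !)))) ⟩
        ∣ ι (n !) ∣ * ∣ j - u ∣
          ≡⟨ sym (ℚ.∣p*q∣≡∣p∣*∣q∣ (ι (n !)) (j - u)) ⟩
        ∣ ι (n !) * (j - u) ∣
          ≡⟨ cong ∣_∣ (solve 3 (λ m j u → m :* (j :- u) := m :* j :- m :* u) refl (ι (n !)) j u) ⟩
        ∣ ι (n !) * j - ι (n !) * u ∣
          ≡⟨ cong₂ (λ x y → ∣ x - y ∣) mass (ι*1/ (n !) {{n ℕ.!≢0}}) ⟩
        ∣ (total q ^ n - ∑ πs error) - 1ℚ ∣
          ≡⟨ cong ∣_∣ (solve 3 (λ s e o → (s :- e) :- o := (s :- o) :- e) refl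
               (total q ^ n) (∑ πs error) 1ℚ) ⟩
        ∣ (total q ^ n - 1ℚ) - ∑ πs error ∣
          ≤⟨ ℚ.∣p-q∣≤∣p∣+∣q∣ (total q ^ n - 1ℚ) (∑ πs error) ⟩
        D + ∣ ∑ πs error ∣
          ≤⟨ ℚ.+-monoʳ-≤ D (ℚ.≤-trans (∣∑∣≤∑∣∣ πs error) ∑-∣error∣) ⟩
        D + E ∎
        where
        open ℚ.≤-Reasoning
        j : ℚ
        j = main Perm.id
        mass : ι (n !) * j ≡ total q ^ n - ∑ πs error
        mass = trans (sym (∑-permutations-const n j)) (trans (∑-cong πs (sym ∘ main-constant))
          (trans (solve 2 (λ m e → m := (m :+ e) :- e) refl (∑ πs main) (∑ πs error))
            (cong (_- ∑ πs error) (trans (sym (∑-+ πs main error))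
              (trans (∑-cong πs (sym ∘ law-split)) ∑-law)))))

    law-distance : ½ * (∑[ π ∈ permutations n ] ∣ law q π - u ∣) ≤
      ι (n C 2) * (∑ (allFin a) (λ x → q x * q x) * total (∣_∣ ∘ q) ^ (n ℕ.∸ 2)) +
      ∣ total q ^ n - 1ℚ ∣
    law-distance = begin
      ½ * (∑[ π ∈ πs ] ∣ law q π - u ∣)
        ≤⟨ *-monoˡ-≤ ½ 0≤½ (∑-mono πs λ π → triangle π) ⟩
      ½ * (∑[ π ∈ πs ] (∣ error π ∣ + ∣ main π - u ∣))
        ≡⟨ cong (½ *_) (∑-+ πs _ _) ⟩
      ½ * ((∑[ π ∈ πs ] ∣ error π ∣) + (∑[ π ∈ πs ] ∣ main π - u ∣))
        ≤⟨ *-monoˡ-≤ ½ 0≤½ (ℚ.+-mono-≤ ∑-∣error∣ ∑-∣main-u∣) ⟩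
      ½ * (E + (D + E))
        ≡⟨ solve 2 (λ e d → con ½ :* (e :+ (d :+ e)) := e :+ con ½ :* d) refl E D ⟩
      E + ½ * D
        -- Replacing `½ * D` by `D` is harmless: for the weights approximating a probability vector,
        -- `D` tends to 0.
        ≤⟨ ℚ.+-mono-≤ (Bounds.∑-collisions r (λ x → ℚ.0≤∣p∣ (q x)) n) ½D≤D ⟩
      ι (n C 2) * (∑ (allFin a) (λ x → r x * r x) * total r ^ (n ℕ.∸ 2)) + D
        ≡⟨ cong (λ s → ι (n C 2) * (s * total r ^ (n ℕ.∸ 2)) + D)
             (∑-cong (allFin a) λ x → ∣∣-square (q x)) ⟩
      ι (n C 2) * (∑ (allFin a) (λ x → q x * q x) * total r ^ (n ℕ.∸ 2)) + D ∎
      where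
      open ℚ.≤-Reasoning
      0≤½ : 0ℚ ≤ ½
      0≤½ = ℚ.nonNegative⁻¹ ½
      ½D≤D : ½ * D ≤ D
      ½D≤D = subst (½ * D ≤_) (solve 1 (λ d → con ½ :* d :+ con ½ :* d := d) refl D)
        (subst (_≤ ½ * D + ½ * D) (ℚ.+-identityʳ (½ * D))
          (ℚ.+-monoʳ-≤ (½ * D) (0≤* 0≤½ (ℚ.0≤∣p∣ (total q ^ n - 1ℚ)))))
      triangle : ∀ π → ∣ law q π - u ∣ ≤ ∣ error π ∣ + ∣ main π - u ∣
      triangle π = subst (λ x → ∣ x ∣ ≤ ∣ error π ∣ + ∣ main π - u ∣)
        (trans (solve 3 (λ m e u → e :+ (m :- u) := (m :+ e) :- u) refl (main π) (error π) u)
          (cong (_- u) (sym (law-split π))))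
        (ℚ.∣p+q∣≤∣p∣+∣q∣ (error π) (main π - u))

  -- One induction serves three multiplicative functions: the square for the collision probability,
  -- the absolute value for the free letters, and the identity for the total mass.
  ∑-⊗^ : ∀ (F : ℚ → ℚ) → F 1ℚ ≡ 1ℚ → (∀ x y → F (x * y) ≡ F x * F y) →
    ∀ {a} (q : Fin a → ℚ) k → ∑ (allFin (a ℕ.^ k)) (F ∘ (q ⊗^ k)) ≡ ∑ (allFin a) (F ∘ q) ^ k
  ∑-⊗^ F F-1 F-* q zero    = trans (ℚ.+-identityʳ (F 1ℚ)) F-1
  ∑-⊗^ F F-1 F-* {a} q (suc k) = begin
    ∑ (allFin (a ℕ.* a ℕ.^ k)) (F ∘ (q ⊗ (q ⊗^ k)))
      ≡⟨ ∑-combine a (a ℕ.^ k) _ ⟩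
    ∑[ x ∈ allFin a ] ∑[ y ∈ allFin (a ℕ.^ k) ] F ((q ⊗ (q ⊗^ k)) (combine x y))
      ≡⟨ ∑-cong (allFin a) (λ x → ∑-cong (allFin (a ℕ.^ k)) λ y →
           trans (cong F (⊗-combine q (q ⊗^ k) x y)) (F-* (q x) ((q ⊗^ k) y))) ⟩
    ∑[ x ∈ allFin a ] ∑[ y ∈ allFin (a ℕ.^ k) ] F (q x) * F ((q ⊗^ k) y)
      ≡⟨ ∑-product (allFin a) (allFin (a ℕ.^ k)) (F ∘ q) (F ∘ (q ⊗^ k)) ⟩
    ∑ (allFin a) (F ∘ q) * ∑ (allFin (a ℕ.^ k)) (F ∘ (q ⊗^ k))
      ≡⟨ cong (∑ (allFin a) (F ∘ q) *_) (∑-⊗^ F F-1 F-* q k) ⟩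
    ∑ (allFin a) (F ∘ q) * ∑ (allFin a) (F ∘ q) ^ k ∎
    where open ≡-Reasoning

  law-power-distance : ∀ n k (q : Fin a → ℚ) →
    ½ * (∑[ π ∈ permutations n ] ∣ law (q ⊗^ k) π - (ℤ.+ 1 ℚ./ (n !)) {{n ℕ.!≢0}} ∣) ≤
    ι (n C 2) * (∑ (allFin a) (λ x → q x * q x) ^ k * (total (∣_∣ ∘ q) ^ k) ^ (n ℕ.∸ 2)) +
    ∣ (total q ^ k) ^ n - 1ℚ ∣
  law-power-distance {a} n k q = subst
    (½ * (∑[ π ∈ permutations n ] ∣ law (q ⊗^ k) π - (ℤ.+ 1 ℚ./ (n !)) {{n ℕ.!≢0}} ∣) ≤_)
    (cong₂ _+_
      (cong (ι (n C 2) *_) (cong₂ _*_ (∑-⊗^ (λ x → x * x) refl square-* q k)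
        (cong (_^ (n ℕ.∸ 2)) (∑-⊗^ ∣_∣ refl ℚ.∣p*q∣≡∣p∣*∣q∣ q k))))
      (cong (λ s → ∣ s ^ n - 1ℚ ∣) (∑-⊗^ id refl (λ _ _ → refl) q k)))
    (law-distance {n = n} (q ⊗^ k))
    where
    square-* : ∀ x y → (x * y) * (x * y) ≡ (x * x) * (y * y)
    square-* = solve 2 (λ x y → (x :* y) :* (x :* y) := (x :* x) :* (y :* y)) refl

open Distance

open import Defs

-- Limits of Cauchy sequences, as far as the corrections require.

module Limits where

  open +-*-Solver using (solve; _:=_; _:+_; _:*_; _:-_; :-_; con)

  private
    halves : ∀ ε → ε ℚ.* ½ ℚ.+ ε ℚ.* ½ ≡ ε
    halves = solve 1 (λ ε → ε :* con ½ :+ ε :* con ½ := ε) refl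

    0<half : ∀ {ε} → 0ℚ ℚ.< ε → 0ℚ ℚ.< ε ℚ.* ½
    0<half {ε} 0<ε = subst (ℚ._< ε ℚ.* ½) (ℚ.*-zeroˡ ½) (ℚ.*-monoˡ-<-pos ½ 0<ε)

    ⊔-≤ˡ : ∀ {M N n} → M ℕ.⊔ N ℕ.≤ n → M ℕ.≤ n
    ⊔-≤ˡ {M} {N} = ℕ.m⊔n≤o⇒m≤o M N

    ⊔-≤ʳ : ∀ {M N n} → M ℕ.⊔ N ℕ.≤ n → N ℕ.≤ n
    ⊔-≤ʳ {M} {N} = ℕ.m⊔n≤o⇒n≤o M N

  pointwise⇒≃ : ∀ x y → (∀ n → seq x n ≡ seq y n) → x ≃ y
  pointwise⇒≃ x y eq = mk≃ λ ε 0<ε → 0 , λ n _ → subst (ℚ._≤ ε)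
    (sym (cong ℚ.∣_∣ (trans (cong (ℚ._- seq y n) (eq n)) (ℚ.+-inverseʳ (seq y n))))) (ℚ.<⇒≤ 0<ε)

  ≃-trans : ∀ {x y z} → x ≃ y → y ≃ z → x ≃ z
  ≃-trans {x} {y} {z} (mk≃ x≃y) (mk≃ y≃z) = mk≃ λ ε 0<ε →
    let M , p = x≃y (ε ℚ.* ½) (0<half 0<ε)
        N , q = y≃z (ε ℚ.* ½) (0<half 0<ε)
    in M ℕ.⊔ N , λ n ≤n → subst (ℚ.∣ seq x n ℚ.- seq z n ∣ ℚ.≤_) (halves ε)
      (subst (λ d → ℚ.∣ d ∣ ℚ.≤ ε ℚ.* ½ ℚ.+ ε ℚ.* ½)
        (solve 3 (λ x y z → (x :- y) :+ (y :- z) := x :- z) refl (seq x n) (seq y n) (seq z n))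
        (ℚ.≤-trans (ℚ.∣p+q∣≤∣p∣+∣q∣ (seq x n ℚ.- seq y n) (seq y n ℚ.- seq z n))
          (ℚ.+-mono-≤ (p n (⊔-≤ˡ ≤n)) (q n (⊔-≤ʳ ≤n)))))

  +-cong : ∀ {x x′ y y′} → x ≃ x′ → y ≃ y′ → x + y ≃ x′ + y′
  +-cong {x} {x′} {y} {y′} (mk≃ x≃x′) (mk≃ y≃y′) = mk≃ λ ε 0<ε →
    let M , p = x≃x′ (ε ℚ.* ½) (0<half 0<ε)
        N , q = y≃y′ (ε ℚ.* ½) (0<half 0<ε)
    in M ℕ.⊔ N , λ n ≤n →
      subst (ℚ.∣ (seq x n ℚ.+ seq y n) ℚ.- (seq x′ n ℚ.+ seq y′ n) ∣ ℚ.≤_) (halves ε)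
      (subst (λ d → ℚ.∣ d ∣ ℚ.≤ ε ℚ.* ½ ℚ.+ ε ℚ.* ½)
        (solve 4 (λ x x′ y y′ → (x :- x′) :+ (y :- y′) := (x :+ y) :- (x′ :+ y′)) refl
          (seq x n) (seq x′ n) (seq y n) (seq y′ n))
        (ℚ.≤-trans (ℚ.∣p+q∣≤∣p∣+∣q∣ (seq x n ℚ.- seq x′ n) (seq y n ℚ.- seq y′ n))
          (ℚ.+-mono-≤ (p n (⊔-≤ˡ ≤n)) (q n (⊔-≤ʳ ≤n)))))

  eventuallyBounded : ∀ x → ∃ λ B → ℚ.Positive B × ∃ λ N → ∀ n → N ℕ.≤ n → ℚ.∣ seq x n ∣ ℚ.≤ B
  eventuallyBounded x = let N , close = cauchy x 1ℚ (ℚ.positive⁻¹ 1ℚ) in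
    1ℚ ℚ.+ ℚ.∣ seq x N ∣ , ℚ.pos+nonNeg⇒pos 1ℚ ℚ.∣ seq x N ∣ {{ℚ.∣-∣-nonNeg (seq x N)}} , N ,
    λ n N≤n → ℚ.≤-trans
      (subst (λ y → ℚ.∣ y ∣ ℚ.≤ ℚ.∣ seq x n ℚ.- seq x N ∣ ℚ.+ ℚ.∣ seq x N ∣)
        (solve 2 (λ x y → (x :- y) :+ y := x) refl (seq x n) (seq x N))
        (ℚ.∣p+q∣≤∣p∣+∣q∣ (seq x n ℚ.- seq x N) (seq x N)))
      (ℚ.+-monoˡ-≤ ℚ.∣ seq x N ∣ (close n N N≤n ℕ.≤-refl))

  *-congˡ : ∀ x {y y′} → y ≃ y′ → x * y ≃ x * y′
  *-congˡ x {y} {y′} (mk≃ y≃y′) = mk≃ λ ε 0<ε →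
    let B , B>0 , M , bound = eventuallyBounded x
        δ , 0<δ , Bδ≡ε      = quotient B {{B>0}} 0<ε
        N , p               = y≃y′ δ 0<δ
    in M ℕ.⊔ N , λ n ≤n → subst (ℚ.∣ seq x n ℚ.* seq y n ℚ.- seq x n ℚ.* seq y′ n ∣ ℚ.≤_) Bδ≡ε
      (close {{B>0}} (seq x n) (seq y n) (seq y′ n) (bound n (⊔-≤ˡ ≤n)) (p n (⊔-≤ʳ ≤n)))
    where
    quotient : ∀ B .{{_ : ℚ.Positive B}} {ε} → 0ℚ ℚ.< ε → ∃ λ δ → 0ℚ ℚ.< δ × B ℚ.* δ ≡ ε
    quotient B {ε} 0<ε = ℚ.1/ B ℚ.* ε ,
      subst (ℚ._< ℚ.1/ B ℚ.* ε) (ℚ.*-zeroʳ (ℚ.1/ B))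
        (ℚ.*-monoʳ-<-pos (ℚ.1/ B) {{ℚ.1/pos⇒pos B}} 0<ε) ,
      trans (sym (ℚ.*-assoc B (ℚ.1/ B) ε))
        (trans (cong (ℚ._* ε) (ℚ.*-inverseʳ B)) (ℚ.*-identityˡ ε))
      where
      instance
        B≢0 : ℚ.NonZero B
        B≢0 = ℚ.pos⇒nonZero B
    close : ∀ {B δ} .{{_ : ℚ.Positive B}} x y z → ℚ.∣ x ∣ ℚ.≤ B → ℚ.∣ y ℚ.- z ∣ ℚ.≤ δ →
      ℚ.∣ x ℚ.* y ℚ.- x ℚ.* z ∣ ℚ.≤ B ℚ.* δ
    close {B} {δ} x y z x≤B y-z≤δ = begin
      ℚ.∣ x ℚ.* y ℚ.- x ℚ.* z ∣
        ≡⟨ cong ℚ.∣_∣ (solve 3 (λ x y z → x :* y :- x :* z := x :* (y :- z)) refl x y z) ⟩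
      ℚ.∣ x ℚ.* (y ℚ.- z) ∣
        ≡⟨ ℚ.∣p*q∣≡∣p∣*∣q∣ x (y ℚ.- z) ⟩
      ℚ.∣ x ∣ ℚ.* ℚ.∣ y ℚ.- z ∣
        ≤⟨ ℚ.*-monoʳ-≤-nonNeg ℚ.∣ y ℚ.- z ∣ {{ℚ.∣-∣-nonNeg (y ℚ.- z)}} x≤B ⟩
      B ℚ.* ℚ.∣ y ℚ.- z ∣
        ≤⟨ ℚ.*-monoˡ-≤-nonNeg B {{ℚ.pos⇒nonNeg B}} y-z≤δ ⟩
      B ℚ.* δ ∎
      where open ℚ.≤-Reasoning

  ^-≃1 : ∀ x → x ≃ 1ℝ → ∀ k → x ^ k ≃ 1ℝ
  ^-≃1 x x≃1 zero    = pointwise⇒≃ (x ^ 0) 1ℝ λ _ → refl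
  ^-≃1 x x≃1 (suc k) = ≃-trans {x ^ suc k} {x * x ^ k} {1ℝ}
    (pointwise⇒≃ (x ^ suc k) (x * x ^ k) λ _ → refl)
    (≃-trans {x * x ^ k} {x * 1ℝ} {1ℝ} (*-congˡ x {x ^ k} {1ℝ} (^-≃1 x x≃1 k))
      (≃-trans {x * 1ℝ} {x} {1ℝ} (pointwise⇒≃ (x * 1ℝ) x λ n → ℚ.*-identityʳ (seq x n)) x≃1))

  sum-cong : ∀ {a} (s t : Fin a → ℝ) → (∀ i → s i ≃ t i) → sum s ≃ sum t
  sum-cong {zero}  s t s≃t = pointwise⇒≃ (sum s) (sum t) λ _ → refl
  sum-cong {suc a} s t s≃t = ≃-trans {sum s} {s zero + sum (s ∘ suc)} {sum t}
    (pointwise⇒≃ (sum s) (s zero + sum (s ∘ suc)) λ _ → refl)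
    (≃-trans {s zero + sum (s ∘ suc)} {t zero + sum (t ∘ suc)} {sum t}
      (+-cong {s zero} {t zero} {sum (s ∘ suc)} {sum (t ∘ suc)}
        (s≃t zero) (sum-cong (s ∘ suc) (t ∘ suc) (s≃t ∘ suc)))
      (pointwise⇒≃ (t zero + sum (t ∘ suc)) (sum t) λ _ → refl))

  -- Nonnegativity of the limit only says that the terms are eventually at least minus any given
  -- tolerance. For a negative term, `∣ x ∣ - x` is twice its absolute value, hence the tolerance
  -- `ε * ½`.
  nonNeg⇒∣x∣≃x : ∀ {x} → 0ℝ ≤ x → ∣ x ∣ ≃ x
  nonNeg⇒∣x∣≃x {x} (mk≤ 0≤x) = mk≃ λ ε 0<ε →
    let N , p = 0≤x (ε ℚ.* ½) (0<half 0<ε) in N , λ n N≤n → close ε 0<ε (seq x n) (p n N≤n)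
    where
    close : ∀ ε → 0ℚ ℚ.< ε → ∀ x → 0ℚ ℚ.≤ x ℚ.+ ε ℚ.* ½ → ℚ.∣ ℚ.∣ x ∣ ℚ.- x ∣ ℚ.≤ ε
    close ε 0<ε x 0≤x+δ with ℚ.∣p∣≡p∨∣p∣≡-p x
    ... | inj₁ eq = subst (ℚ._≤ ε)
      (sym (cong ℚ.∣_∣ (trans (cong (ℚ._- x) eq) (ℚ.+-inverseʳ x)))) (ℚ.<⇒≤ 0<ε)
    ... | inj₂ eq = begin
      ℚ.∣ ℚ.∣ x ∣ ℚ.- x ∣             ≤⟨ ℚ.∣p-q∣≤∣p∣+∣q∣ ℚ.∣ x ∣ x ⟩
      ℚ.∣ ℚ.∣ x ∣ ∣ ℚ.+ ℚ.∣ x ∣       ≡⟨ cong₂ ℚ._+_ (trans (ℚ.∣∣p∣∣≡∣p∣ x) eq) eq ⟩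
      ℚ.- x ℚ.+ ℚ.- x                 ≤⟨ ℚ.+-mono-≤ -x≤δ -x≤δ ⟩
      ε ℚ.* ½ ℚ.+ ε ℚ.* ½             ≡⟨ halves ε ⟩
      ε                               ∎
      where
      open ℚ.≤-Reasoning
      -x≤δ : ℚ.- x ℚ.≤ ε ℚ.* ½
      -x≤δ = subst₂ ℚ._≤_ (ℚ.+-identityʳ (ℚ.- x))
        (solve 2 (λ x d → (:- x) :+ (x :+ d) := d) refl x (ε ℚ.* ½))
        (ℚ.+-monoʳ-≤ (ℚ.- x) 0≤x+δ)

  ∣x-1∣≃0 : ∀ {x} → x ≃ 1ℝ → ∣ x - 1ℝ ∣ ≃ 0ℝ
  ∣x-1∣≃0 {x} (mk≃ x≃1) = mk≃ λ ε 0<ε →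
    let N , p = x≃1 ε 0<ε in N , λ n N≤n → subst (ℚ._≤ ε)
      (sym (trans (cong ℚ.∣_∣ (ℚ.+-identityʳ ℚ.∣ seq x n ℚ.- 1ℚ ∣)) (ℚ.∣∣p∣∣≡∣p∣ (seq x n ℚ.- 1ℚ))))
      (p n N≤n)

  pointwise-≤-≃ : ∀ {x y z} → (∀ n → seq x n ℚ.≤ seq y n) → y ≃ z → x ≤ z
  pointwise-≤-≃ {x} {y} {z} x≤y (mk≃ y≃z) = mk≤ λ ε 0<ε →
    let N , p = y≃z ε 0<ε in N , λ n N≤n → ℚ.≤-trans (x≤y n)
      (subst (ℚ._≤ seq z n ℚ.+ ε)
        (solve 2 (λ y z → z :+ (y :- z) := y) refl (seq y n) (seq z n))
        (ℚ.+-monoʳ-≤ (seq z n) (ℚ.≤-trans (p≤∣p∣ (seq y n ℚ.- seq z n)) (p n N≤n))))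
    where
    p≤∣p∣ : ∀ p → p ℚ.≤ ℚ.∣ p ∣
    p≤∣p∣ p with ℚ.≤-total 0ℚ p
    ... | inj₁ 0≤p = ℚ.≤-reflexive (sym (ℚ.0≤p⇒∣p∣≡p 0≤p))
    ... | inj₂ p≤0 = ℚ.≤-trans p≤0 (ℚ.0≤∣p∣ p)

  -- The factor `t` and the summand with `s` are the two corrections of the rational bound. They
  -- disappear only in the limit, so the termwise inequality is weaker than the one concluded.
  ≤-from-approximations : ∀ x c r s t → s ≃ 1ℝ → t ≃ 1ℝ →
    (∀ m → seq x m ℚ.≤ seq c m ℚ.* (seq r m ℚ.* seq t m) ℚ.+ ℚ.∣ seq s m ℚ.- 1ℚ ∣) → x ≤ c * r
  ≤-from-approximations x c r s t s≃1 t≃1 x≤ =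
    pointwise-≤-≃ {x} {c * (r * t) + ∣ s - 1ℝ ∣} {c * r} x≤
      (≃-trans {c * (r * t) + ∣ s - 1ℝ ∣} {c * (r * 1ℝ) + 0ℝ} {c * r}
        (+-cong {c * (r * t)} {c * (r * 1ℝ)} {∣ s - 1ℝ ∣} {0ℝ}
          (*-congˡ c {r * t} {r * 1ℝ} (*-congˡ r {t} {1ℝ} t≃1)) (∣x-1∣≃0 {s} s≃1))
        (pointwise⇒≃ (c * (r * 1ℝ) + 0ℝ) (c * r) λ m →
          trans (ℚ.+-identityʳ (seq c m ℚ.* (seq r m ℚ.* 1ℚ)))
            (cong (seq c m ℚ.*_) (ℚ.*-identityʳ (seq r m)))))

-- Terms of the real sequences as exact rational computations with the weights `q`.

module Approximation where

  open import Data.Fin.Permutation using (_≈_)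

  seq-sumOver : ∀ {A : Set} (xs : List A) f m → seq (sumOver xs f) m ≡ ∑ xs (λ x → seq (f x) m)
  seq-sumOver []       f m = refl
  seq-sumOver (x ∷ xs) f m = cong (seq (f x) m ℚ.+_) (seq-sumOver xs f m)

  seq-sum : ∀ {a} (t : Fin a → ℝ) m → seq (sum t) m ≡ ∑ (allFin a) (λ i → seq (t i) m)
  seq-sum t m = go t id
    where
    go : ∀ {a c} (t : Fin c → ℝ) (h : Fin a → Fin c) →
      seq (sum (t ∘ h)) m ≡ ∑ (List.tabulate h) (λ i → seq (t i) m)
    go {zero}  t h = refl
    go {suc a} t h = cong (seq (t (h zero)) m ℚ.+_) (go t (h ∘ suc))

  seq-^ : ∀ x k m → seq (x ^ k) m ≡ seq x m RationalPowers.^ k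
  seq-^ x zero    m = refl
  seq-^ x (suc k) m = cong (seq x m ℚ.*_) (seq-^ x k m)

  seq-product : ∀ {a} (t : Fin a → ℝ) m → seq (product t) m ≡ RationalPowers.product (λ i → seq (t i) m)
  seq-product {zero}  t m = refl
  seq-product {suc a} t m = cong (seq (t zero) m ℚ.*_) (seq-product (t ∘ suc) m)

  seq-if : ∀ {P : Set} (P? : Dec P) x m →
    seq (if Dec.does P? then fromℚ x else 0ℝ) m ≡ x ℚ.* 𝟙 P?
  seq-if (yes _) x m = sym (ℚ.*-identityʳ x)
  seq-if (no  _) x m = sym (ℚ.*-zeroʳ x)

  module _ {a} (p : Fin a → ℝ) (m : ℕ) where

    q : Fin a → ℚ
    q i = seq (p i) m

    -- The multinomial coefficient in the probability of the composition cancels the one by which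
    -- the second stage divides, leaving the bare product of powers that `law-compositions` sums.
    seq-shuffle : ∀ n π → seq (shuffle n p π) m ≡ law q π
    seq-shuffle n π = trans (seq-sumOver (compositions a n) _ m)
      (trans (∑-cong (compositions a n) term) (law-compositions q π))
      where
      open ≡-Reasoning
      term : ∀ b → seq ((fromℕ (multinomial b) * product (λ i → p i ^ lookup b i)) * givenCuts b π) m
        ≡ RationalPowers.product (λ i → q i RationalPowers.^ lookup b i) ℚ.*
          𝟙 (descentsWithin? b (flip π))
      term b = begin
        (ι M ℚ.* seq (product (λ i → p i ^ lookup b i)) m) ℚ.* seq (givenCuts b π) m
          ≡⟨ cong₂ (λ x y → (ι M ℚ.* x) ℚ.* y)
               (trans (seq-product (λ i → p i ^ lookup b i) m)
                 (RationalPowers.product-cong λ i → seq-^ (p i) (lookup b i) m))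
               (seq-if (descentsWithin? b (flip π)) 1/M m) ⟩
        (ι M ℚ.* P) ℚ.* (1/M ℚ.* I)
          ≡⟨ solve 4 (λ m p d i → (m :* p) :* (d :* i) := (m :* d) :* (p :* i)) refl (ι M) P 1/M I ⟩
        (ι M ℚ.* 1/M) ℚ.* (P ℚ.* I)
          ≡⟨ cong (ℚ._* (P ℚ.* I)) (ι*1/ M {{multinomial≢0 b}}) ⟩
        1ℚ ℚ.* (P ℚ.* I)
          ≡⟨ ℚ.*-identityˡ (P ℚ.* I) ⟩
        P ℚ.* I ∎
        where
        open +-*-Solver using (solve; _:=_; _:*_)
        M : ℕ
        M = multinomial b
        1/M P I : ℚ
        1/M = (ℤ.+ 1 ℚ./ M) {{multinomial≢0 b}}
        P   = RationalPowers.product λ i → q i RationalPowers.^ lookup b i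
        I   = 𝟙 (descentsWithin? b (flip π))

    seq-shuffle^ : ∀ {n} k (π : Permutation′ n) → seq ((shuffle n p ⋆^ k) π) m ≡ law (q ⊗^ k) π
    seq-shuffle^ {n} zero    π = trans (seq-if (id≈? π) 1ℚ m)
      (trans (ℚ.*-identityˡ (𝟙 (id≈? π))) (sym (law-one-letter id≈? π)))
      where
      id≈? : ∀ (π : Permutation′ n) → Dec (Perm.id ≈ π)
      id≈? π = Fin.all? λ i → i Fin.≟ (π ⟨$⟩ʳ i)
    seq-shuffle^ {n} (suc k) π = trans (seq-sumOver (permutations n) _ m)
      (trans (∑-cong (permutations n) λ σ →
          cong₂ ℚ._*_ (seq-shuffle n σ) (seq-shuffle^ k (π ∘ₚ flip σ)))
        (law-convolution q (q ⊗^ k) π))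

    seq-totalVariation : ∀ n k → seq (totalVariation (shuffle n p ⋆^ k) (uniform n)) m ≡
      ½ ℚ.* (∑[ π ∈ permutations n ] ℚ.∣ law (q ⊗^ k) π ℚ.- (ℤ.+ 1 ℚ./ (n !)) {{n ℕ.!≢0}} ∣)
    seq-totalVariation n k = cong (½ ℚ.*_) (trans (seq-sumOver (permutations n) _ m)
      (∑-cong (permutations n) λ π →
        cong (λ x → ℚ.∣ x ℚ.- (ℤ.+ 1 ℚ./ (n !)) {{n ℕ.!≢0}} ∣) (seq-shuffle^ k π)))

open Limits
open Approximation

theorem1 : ∀ (n a k : ℕ) → 1 ℕ.≤ n → 1 ℕ.≤ a → 1 ℕ.≤ k →
    (p : Fin a → ℝ) → IsProbabilityVector p →
    totalVariation (shuffle n p ⋆^ k) (uniform n)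
    ≤ fromℕ (n C 2) * (sum (λ i → p i ^ 2)) ^ k
theorem1 n a k _ _ _ p (p≥0 , Σp≃1) =
  conclude (fromℕ (n C 2)) (sum (λ i → p i ^ 2) ^ k) refl refl
    (≤-from-approximations (totalVariation (shuffle n p ⋆^ k) (uniform n))
    (fromℕ (n C 2)) (sum (λ i → p i ^ 2) ^ k) ((sum p ^ k) ^ n) ((sum ∣p∣ ^ k) ^ (n ℕ.∸ 2))
    (^-≃1 (sum p ^ k) (^-≃1 (sum p) Σp≃1 k) n)
    (^-≃1 (sum ∣p∣ ^ k) (^-≃1 (sum ∣p∣) ∣p∣-total k) (n ℕ.∸ 2))
    approximation)
  where
  -- With c and r variables, the two sides of the product are identified without
  -- unfolding the multiplication of reals, which is too slow.
  conclude : ∀ c r → c ≡ fromℕ (n C 2) → r ≡ sum (λ i → p i ^ 2) ^ k →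
    totalVariation (shuffle n p ⋆^ k) (uniform n) ≤ c * r →
    totalVariation (shuffle n p ⋆^ k) (uniform n) ≤ fromℕ (n C 2) * (sum (λ i → p i ^ 2)) ^ k
  conclude c r refl refl h = h

  ∣p∣ : Fin a → ℝ
  ∣p∣ i = ∣ p i ∣

  -- Here the nonnegativity of `p` enters: individual terms of the sequences may be negative, yet
  -- the absolute values have the same limits.
  ∣p∣-total : sum ∣p∣ ≃ 1ℝ
  ∣p∣-total = ≃-trans {sum ∣p∣} {sum p} {1ℝ}
    (sum-cong ∣p∣ p λ i → nonNeg⇒∣x∣≃x {p i} (p≥0 i)) Σp≃1

  approximation : ∀ m → seq (totalVariation (shuffle n p ⋆^ k) (uniform n)) m ℚ.≤
    seq (fromℕ (n C 2)) m ℚ.*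
      (seq (sum (λ i → p i ^ 2) ^ k) m ℚ.* seq ((sum ∣p∣ ^ k) ^ (n ℕ.∸ 2)) m) ℚ.+
    ℚ.∣ seq ((sum p ^ k) ^ n) m ℚ.- 1ℚ ∣
  approximation m = subst₂ ℚ._≤_ (sym (seq-totalVariation p m n k))
    (sym (cong₂ ℚ._+_
      (cong (ι (n C 2) ℚ.*_) (cong₂ ℚ._*_ seq-squares (seq-power ∣p∣ (n ℕ.∸ 2))))
      (cong (λ x → ℚ.∣ x ℚ.- 1ℚ ∣) (seq-power p n))))
    (law-power-distance n k (q p m))
    where
    seq-power : ∀ (t : Fin a → ℝ) j → seq ((sum t ^ k) ^ j) m ≡
      (total (λ i → seq (t i) m) RationalPowers.^ k) RationalPowers.^ j
    seq-power t j = trans (seq-^ (sum t ^ k) j m) (cong (RationalPowers._^ j)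
      (trans (seq-^ (sum t) k m) (cong (RationalPowers._^ k) (seq-sum t m))))
    seq-squares : seq (sum (λ i → p i ^ 2) ^ k) m ≡
      ∑ (allFin a) (λ i → q p m i ℚ.* q p m i) RationalPowers.^ k
    seq-squares = trans (seq-^ (sum (λ i → p i ^ 2)) k m) (cong (RationalPowers._^ k)
      -- The square unfolds to a product ending in a factor 1, which has to be removed.
      (trans (seq-sum (λ i → p i ^ 2) m) (∑-cong (allFin a) λ i →
        cong (q p m i ℚ.*_) (ℚ.*-identityʳ (q p m i)))))
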